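{- There exist absolute constants $c, C > 0$ such that for every integer $H \geq 3$, $$c\sqrt{H/\log H} \leq \kappa(H) \leq C H.$$
   Context: For a subset $A \subseteq \mathbb{Z}$ and a positive integer $h$, the $h$-fold iterated sumset is $hA:=\{a_1+\cdots+a_h : a_1,\ldots,a_h \in A\}$ (repetitions allowed), and $|X|$ denotes the cardinality of a finite set $X$. For a positive integer $H$, $\kappa(H)$ denotes the smallest natural number $k$ such that for each choice of signs $\epsilon_1, \ldots, \epsilon_H \in \{ -,+\}$, there are sets $A,B \subseteq \mathbb{Z}$, each of size at most $k$, such that $|hA|-|hB|$ has the same sign as $\epsilon_h$ for each $1 \leq h \leq H$ (that is, $|hA|-|hB|>0$ if $\epsilon_h = +$ and $|hA|-|hB|<0$ if $\epsilon_h=-$). Such a $k$ exists for every $H$. $\log$ is the natural logarithm. -}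

module Defs where

open import Data.Empty using (⊥)
open import Data.Fin using (Fin; toℕ)
open import Data.Integer as ℤ using (ℤ; 0ℤ; +_; -[1+_]; +[1+_]; +<+)
import Data.Integer.Properties as ℤ
open import Data.List using (List; []; _∷_; length; deduplicate; cartesianProductWith)
open import Data.Nat as ℕ using (ℕ; zero; suc; NonZero)
import Data.Nat.Properties as ℕ
open import Data.Product using (∃; _×_; _,_; proj₁; proj₂)
open import Data.Rational as ℚ using (ℚ; 0ℚ; 1ℚ; mkℚ)
import Data.Rational.Properties as ℚ
open import Data.Rational.Unnormalised as ℚᵘ using (mkℚᵘ)
import Data.Rational.Unnormalised.Properties as ℚᵘ
open import Data.Sign using (Sign)
open import Data.Sum using (_⊎_; inj₁; inj₂)
open import Relation.Binary.Definitions using (tri<; tri≈; tri>)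
open import Relation.Binary.PropositionalEquality
open import Relation.Nullary using (contradiction; yes; no)

-- A finite subset of ℤ is given by a list enumerating its elements,
-- possibly with repetitions; its cardinality counts distinct entries.

∣_∣ : List ℤ → ℕ
∣ A ∣ = length (deduplicate ℤ._≟_ A)

infixr 8 _·_

_·_ : ℕ → List ℤ → List ℤ
zero  · A = 0ℤ ∷ []
suc h · A = cartesianProductWith ℤ._+_ A (h · A)

HasSign : Sign → ℤ → Set
HasSign Sign.+ z = 0ℤ ℤ.< z
HasSign Sign.- z = z ℤ.< 0ℤ

-- The index i : Fin H stands for h = toℕ i + 1, so h runs over 1, …, H.

Realises : ℕ → ℕ → Set
Realises H k =
  (ε : Fin H → Sign) →
  ∃ λ (A : List ℤ) → ∃ λ (B : List ℤ) →
    (∣ A ∣ ℕ.≤ k) × (∣ B ∣ ℕ.≤ k) ×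
    (∀ i → HasSign (ε i) (+ ∣ suc (toℕ i) · A ∣ ℤ.- + ∣ suc (toℕ i) · B ∣))

-- Isκ H k says κ(H) = k.  It is a relation rather than a function because
-- computing the least k would require a decision procedure for Realises.

Isκ : ℕ → ℕ → Set
Isκ H k = Realises H k × (∀ j → Realises H j → k ℕ.≤ j)

natℚ : ℕ → ℚ
natℚ n = + n ℚ./ 1

natℚ-nonNegative : ∀ n → ℚ.NonNegative (natℚ n)
natℚ-nonNegative n = ℚ.normalize-nonNeg n 1

fromℚᵘ-homo-+ : ∀ p q → ℚ.fromℚᵘ p ℚ.+ ℚ.fromℚᵘ q ≡ ℚ.fromℚᵘ (p ℚᵘ.+ q)
fromℚᵘ-homo-+ p q = ℚ.toℚᵘ-injective
  (ℚᵘ.≃-trans (ℚ.toℚᵘ-homo-+ (ℚ.fromℚᵘ p) (ℚ.fromℚᵘ q))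
  (ℚᵘ.≃-trans (ℚᵘ.+-cong (ℚ.toℚᵘ-fromℚᵘ p) (ℚ.toℚᵘ-fromℚᵘ q))
              (ℚᵘ.≃-sym (ℚ.toℚᵘ-fromℚᵘ (p ℚᵘ.+ q)))))

fromℚᵘ-homo-* : ∀ p q → ℚ.fromℚᵘ p ℚ.* ℚ.fromℚᵘ q ≡ ℚ.fromℚᵘ (p ℚᵘ.* q)
fromℚᵘ-homo-* p q = ℚ.toℚᵘ-injective
  (ℚᵘ.≃-trans (ℚ.toℚᵘ-homo-* (ℚ.fromℚᵘ p) (ℚ.fromℚᵘ q))
  (ℚᵘ.≃-trans (ℚᵘ.*-cong (ℚ.toℚᵘ-fromℚᵘ p) (ℚ.toℚᵘ-fromℚᵘ q))
              (ℚᵘ.≃-sym (ℚ.toℚᵘ-fromℚᵘ (p ℚᵘ.* q)))))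

natℚ-suc : ∀ n → natℚ (suc n) ≡ 1ℚ ℚ.+ natℚ n
natℚ-suc n = sym (trans (fromℚᵘ-homo-+ (mkℚᵘ (+ 1) 0) (mkℚᵘ (+ n) 0))
  (ℚ.fromℚᵘ-cong {mkℚᵘ (+ 1) 0 ℚᵘ.+ mkℚᵘ (+ n) 0} {mkℚᵘ (+ suc n) 0}
    (ℚᵘ.*≡* (cong (ℤ._* + 1) (cong (ℤ._+_ (+ 1)) (ℤ.*-identityʳ (+ n)))))))

natℚ-suc-* : ∀ n c → natℚ (suc n) ℚ.* c ≡ c ℚ.+ natℚ n ℚ.* c
natℚ-suc-* n c = trans (cong (ℚ._* c) (natℚ-suc n))
  (trans (ℚ.*-distribʳ-+ c 1ℚ (natℚ n)) (cong (ℚ._+ natℚ n ℚ.* c) (ℚ.*-identityˡ c)))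

archimedean : ∀ q → ∃ λ n → q ℚ.< natℚ n
archimedean q@(mkℚ a d _) = n , ℚ.toℚᵘ-cancel-<
  (ℚᵘ.<-respʳ-≃ (ℚᵘ.≃-sym (ℚ.toℚᵘ-fromℚᵘ (mkℚᵘ (+ n) 0))) (ℚᵘ.*<* step))
  where
  n : ℕ
  n = suc ℤ.∣ a ∣
  a<n : ∀ b → b ℤ.< + suc ℤ.∣ b ∣
  a<n (+ m)    = +<+ ℕ.≤-refl
  a<n -[1+ m ] = ℤ.-<+
  step : a ℤ.* + 1 ℤ.< + n ℤ.* + suc d
  step = subst (ℤ._< + n ℤ.* + suc d) (sym (ℤ.*-identityʳ a))
    (ℤ.<-≤-trans (a<n a)
      (subst (+ n ℤ.≤_) (ℤ.pos-* n (suc d)) (ℤ.+≤+ (ℕ.m≤m*n n (suc d)))))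

unitFraction-small : ∀ δ → .{{ℚ.Positive δ}} → ∃ λ m → + 1 ℚ./ suc m ℚ.< δ
unitFraction-small (mkℚ +[1+ a ] d _) = suc d , ℚ.toℚᵘ-cancel-<
  (ℚᵘ.<-respˡ-≃ (ℚᵘ.≃-sym (ℚ.toℚᵘ-fromℚᵘ (mkℚᵘ (+ 1) (suc d)))) (ℚᵘ.*<* step))
  where
  step : + 1 ℤ.* + suc d ℤ.< + suc a ℤ.* + suc (suc d)
  step = subst₂ ℤ._<_ (ℤ.pos-* 1 (suc d)) (ℤ.pos-* (suc a) (suc (suc d)))
    (+<+ (ℕ.<-≤-trans (ℕ.s≤s (ℕ.≤-reflexive (ℕ.*-identityˡ (suc d))))
                      (ℕ.m≤n*m (suc (suc d)) (suc a))))

unitFraction-antitone : ∀ m n .{{_ : NonZero m}} .{{_ : NonZero n}} →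
  m ℕ.≤ n → + 1 ℚ./ n ℚ.≤ + 1 ℚ./ m
unitFraction-antitone (suc m) (suc n) m≤n = ℚ.toℚᵘ-cancel-≤
  (ℚᵘ.≤-respˡ-≃ (ℚᵘ.≃-sym (ℚ.toℚᵘ-fromℚᵘ (mkℚᵘ (+ 1) n)))
  (ℚᵘ.≤-respʳ-≃ (ℚᵘ.≃-sym (ℚ.toℚᵘ-fromℚᵘ (mkℚᵘ (+ 1) m)))
    (ℚᵘ.*≤* (subst₂ ℤ._≤_ (sym (ℤ.*-identityˡ (+ suc m))) (sym (ℤ.*-identityˡ (+ suc n))) (ℤ.+≤+ m≤n)))))

unitFraction-refine : ∀ m k .{{_ : NonZero m}} .{{_ : NonZero k}} .{{_ : NonZero (m ℕ.* k)}} →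
  natℚ k ℚ.* (+ 1 ℚ./ (m ℕ.* k)) ≡ + 1 ℚ./ m
unitFraction-refine (suc m) (suc k) =
  trans (fromℚᵘ-homo-* (mkℚᵘ (+ suc k) 0) (mkℚᵘ (+ 1) (k ℕ.+ m ℕ.* suc k)))
        (ℚ.fromℚᵘ-cong {mkℚᵘ (+ suc k) 0 ℚᵘ.* mkℚᵘ (+ 1) (k ℕ.+ m ℕ.* suc k)} {mkℚᵘ (+ 1) m}
          (ℚᵘ.*≡* (cong +_ eq)))
  where
  eq : (suc k ℕ.* 1) ℕ.* suc m ≡ 1 ℕ.* (1 ℕ.* (suc m ℕ.* suc k))
  eq = trans (cong (ℕ._* suc m) (ℕ.*-identityʳ (suc k)))
      (trans (ℕ.*-comm (suc k) (suc m))
      (sym (trans (ℕ.*-identityˡ (1 ℕ.* (suc m ℕ.* suc k))) (ℕ.*-identityˡ (suc m ℕ.* suc k)))))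

p-q-positive : ∀ {p q} → p ℚ.< q → ℚ.Positive (q ℚ.- p)
p-q-positive {p} {q} p<q =
  ℚ.positive (subst (ℚ._< q ℚ.- p) (ℚ.+-inverseʳ p) (ℚ.+-monoˡ-< (ℚ.- p) p<q))

p+[q-p]≡q : ∀ p q → p ℚ.+ (q ℚ.- p) ≡ q
p+[q-p]≡q p q = trans (cong (p ℚ.+_) (ℚ.+-comm q (ℚ.- p)))
  (trans (sym (ℚ.+-assoc p (ℚ.- p) q))
  (trans (cong (ℚ._+ q) (ℚ.+-inverseʳ p)) (ℚ.+-identityˡ q)))

record ℚ⁺ : Set where
  no-eta-equality; pattern
  constructor ⟨_⟩
  field
    val         : ℚ
    .{{isPos}}  : ℚ.Positive val

open ℚ⁺ public

val-positive : ∀ p → ℚ.Positive (val p)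
val-positive ⟨ mkℚ +[1+ _ ] _ _ ⟩ = _

val>0 : ∀ p → 0ℚ ℚ.< val p
val>0 p = ℚ.positive⁻¹ (val p) {{val-positive p}}

infix  4 _<⁺_
infixl 7 _*⁺_

record _<⁺_ (p q : ℚ⁺) : Set where
  constructor mk<⁺
  field
    un<⁺ : val p ℚ.< val q

open _<⁺_ public

<⁺-trans : ∀ {p q r} → p <⁺ q → q <⁺ r → p <⁺ r
<⁺-trans (mk<⁺ p<q) (mk<⁺ q<r) = mk<⁺ (ℚ.<-trans p<q q<r)

1⁺ : ℚ⁺
1⁺ = ⟨ 1ℚ ⟩

val-injective : ∀ {p q} → val p ≡ val q → p ≡ q
val-injective {⟨ _ ⟩} {⟨ _ ⟩} refl = refl

-- Opaque so that type checking does not unfold rational arithmetic.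

opaque
  _*⁺_ : ℚ⁺ → ℚ⁺ → ℚ⁺
  p *⁺ q = ⟨ val p ℚ.* val q ⟩ {{ℚ.pos*pos⇒pos (val p) {{val-positive p}} (val q) {{val-positive q}}}}

  inv⁺ : ℚ⁺ → ℚ⁺
  inv⁺ p = ⟨ (ℚ.1/ val p) {{ℚ.pos⇒nonZero (val p) {{val-positive p}}}} ⟩
    {{ℚ.1/pos⇒pos (val p) {{val-positive p}}}}

  *⁺-comm : ∀ p q → p *⁺ q ≡ q *⁺ p
  *⁺-comm p q = val-injective (ℚ.*-comm (val p) (val q))

  *⁺-assoc : ∀ p q r → (p *⁺ q) *⁺ r ≡ p *⁺ (q *⁺ r)
  *⁺-assoc p q r = val-injective (ℚ.*-assoc (val p) (val q) (val r))

  *⁺-identityʳ : ∀ p → p *⁺ 1⁺ ≡ p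
  *⁺-identityʳ p = val-injective (ℚ.*-identityʳ (val p))

  *⁺-inverseʳ : ∀ p → p *⁺ inv⁺ p ≡ 1⁺
  *⁺-inverseʳ p = val-injective (ℚ.*-inverseʳ (val p) {{ℚ.pos⇒nonZero (val p) {{val-positive p}}}})

  inv⁺-involutive : ∀ p → inv⁺ (inv⁺ p) ≡ p
  inv⁺-involutive p = val-injective (ℚ.1/-involutive (val p) {{ℚ.pos⇒nonZero (val p) {{val-positive p}}}})

  val-*⁺ : ∀ p q → val (p *⁺ q) ≡ val p ℚ.* val q
  val-*⁺ p q = refl

  *⁺-monoˡ : ∀ r {p q} → p <⁺ q → p *⁺ r <⁺ q *⁺ r
  *⁺-monoˡ r (mk<⁺ p<q) = mk<⁺ (ℚ.*-monoˡ-<-pos (val r) {{val-positive r}} p<q)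

  *⁺-monoʳ : ∀ r {p q} → p <⁺ q → r *⁺ p <⁺ r *⁺ q
  *⁺-monoʳ r (mk<⁺ p<q) = mk<⁺ (ℚ.*-monoʳ-<-pos (val r) {{val-positive r}} p<q)

[p*r]*r⁻¹≡p : ∀ p r → (p *⁺ r) *⁺ inv⁺ r ≡ p
[p*r]*r⁻¹≡p p r = trans (*⁺-assoc p r (inv⁺ r))
  (trans (cong (p *⁺_) (*⁺-inverseʳ r)) (*⁺-identityʳ p))

[p*r⁻¹]*r≡p : ∀ p r → (p *⁺ inv⁺ r) *⁺ r ≡ p
[p*r⁻¹]*r≡p p r = trans (*⁺-assoc p (inv⁺ r) r)
  (trans (cong (p *⁺_) (trans (*⁺-comm (inv⁺ r) r) (*⁺-inverseʳ r))) (*⁺-identityʳ p))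

*⁺-interchange : ∀ p q r s → (p *⁺ q) *⁺ (r *⁺ s) ≡ (p *⁺ r) *⁺ (q *⁺ s)
*⁺-interchange p q r s = trans (*⁺-assoc p q (r *⁺ s))
  (trans (cong (p *⁺_) (trans (sym (*⁺-assoc q r s))
    (trans (cong (_*⁺ s) (*⁺-comm q r)) (*⁺-assoc r q s))))
  (sym (*⁺-assoc p r (q *⁺ s))))

*⁺-mono : ∀ {p q r s} → p <⁺ q → r <⁺ s → p *⁺ r <⁺ q *⁺ s
*⁺-mono {p} {q} {r} {s} p<q r<s = <⁺-trans (*⁺-monoˡ r p<q) (*⁺-monoʳ q r<s)

*⁺-cancelʳ : ∀ r {p q} → p *⁺ r <⁺ q *⁺ r → p <⁺ q
*⁺-cancelʳ r {p} {q} pr<qr = subst₂ _<⁺_ ([p*r]*r⁻¹≡p p r) ([p*r]*r⁻¹≡p q r)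
  (*⁺-monoˡ (inv⁺ r) pr<qr)

inv⁺-antitone : ∀ {p q} → p <⁺ q → inv⁺ q <⁺ inv⁺ p
inv⁺-antitone {p} {q} p<q = *⁺-cancelʳ p {inv⁺ q} {inv⁺ p}
  (*⁺-cancelʳ q {inv⁺ q *⁺ p} {inv⁺ p *⁺ p}
    (subst₂ _<⁺_ lhs rhs p<q))
  where
  lhs : p ≡ (inv⁺ q *⁺ p) *⁺ q
  lhs = sym (trans (cong (_*⁺ q) (*⁺-comm (inv⁺ q) p)) ([p*r⁻¹]*r≡p p q))
  rhs : q ≡ (inv⁺ p *⁺ p) *⁺ q
  rhs = sym (trans (*⁺-comm (inv⁺ p *⁺ p) q)
    (trans (sym (*⁺-assoc q (inv⁺ p) p)) ([p*r⁻¹]*r≡p q p)))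

dense⁺ : ∀ {p q} → p <⁺ q → ∃ λ r → (p <⁺ r) × (r <⁺ q)
dense⁺ {p} (mk<⁺ p<q) with ℚ.<-dense p<q
... | r , p<r , r<q = ⟨ r ⟩ {{ℚ.positive (ℚ.<-trans (val>0 p) p<r)}} , mk<⁺ p<r , mk<⁺ r<q

1<q/p : ∀ {p q} → p <⁺ q → 1⁺ <⁺ q *⁺ inv⁺ p
1<q/p {p} {q} p<q = subst (_<⁺ q *⁺ inv⁺ p) (*⁺-inverseʳ p) (*⁺-monoˡ (inv⁺ p) p<q)

p<p*s : ∀ p {s} → 1⁺ <⁺ s → p <⁺ p *⁺ s
p<p*s p {s} 1<s = subst (_<⁺ p *⁺ s) (*⁺-identityʳ p) (*⁺-monoʳ p 1<s)

sqrt-below : ∀ {r} → 1⁺ <⁺ r → ∃ λ s → (1⁺ <⁺ s) × (s *⁺ s <⁺ r)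
sqrt-below {r} 1<r with dense⁺ 1<r
... | m , 1<m , m<r with ℚ.<-cmp (val m) (val (r *⁺ inv⁺ m))
...   | tri< m<r/m _ _ = m , 1<m , subst (m *⁺ m <⁺_) ([p*r⁻¹]*r≡p r m) (*⁺-monoˡ m (mk<⁺ m<r/m))
...   | tri≈ _ m≡r/m _ with dense⁺ 1<m
...     | s , 1<s , s<m = s , 1<s , subst (s *⁺ s <⁺_)
            (trans (cong (_*⁺ m) (val-injective m≡r/m)) ([p*r⁻¹]*r≡p r m)) (*⁺-mono s<m s<m)
sqrt-below {r} 1<r | m , 1<m , m<r | tri> _ _ r/m<m =
  s , 1<q/p m<r , subst (s *⁺ s <⁺_) ([p*r⁻¹]*r≡p r m) (*⁺-monoʳ s (mk<⁺ r/m<m))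
  where
  s : ℚ⁺
  s = r *⁺ inv⁺ m

_^⁺_ : ℚ⁺ → ℕ → ℚ⁺
s ^⁺ zero  = 1⁺
s ^⁺ suc n = s *⁺ (s ^⁺ n)

powers-unbounded : ∀ {s} → 1⁺ <⁺ s → ∀ q → ∃ λ n → q <⁺ s ^⁺ n
powers-unbounded {s} 1<s q = n , mk<⁺ (ℚ.<-≤-trans q<nd (bernoulli n))
  where
  d : ℚ⁺
  d = ⟨ val s ℚ.- 1ℚ ⟩ {{p-q-positive (un<⁺ 1<s)}}

  1+d≡s : 1ℚ ℚ.+ val d ≡ val s
  1+d≡s = p+[q-p]≡q 1ℚ (val s)

  s^n≥1 : ∀ n → 1ℚ ℚ.≤ val (s ^⁺ n)
  s^n≥1 zero    = ℚ.≤-refl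
  s^n≥1 (suc n) = ℚ.≤-trans (s^n≥1 n) (ℚ.<⇒≤ (un<⁺
    (subst (s ^⁺ n <⁺_) (*⁺-comm (s ^⁺ n) s) (p<p*s (s ^⁺ n) 1<s))))

  bernoulli : ∀ n → natℚ n ℚ.* val d ℚ.≤ val (s ^⁺ n)
  bernoulli zero    = ℚ.≤-trans (ℚ.≤-reflexive (ℚ.*-zeroˡ (val d))) (ℚ.<⇒≤ (ℚ.positive⁻¹ 1ℚ))
  bernoulli (suc n) = begin
    natℚ (suc n) ℚ.* val d                     ≡⟨ natℚ-suc-* n (val d) ⟩
    val d ℚ.+ natℚ n ℚ.* val d                 ≤⟨ ℚ.+-monoʳ-≤ (val d) (bernoulli n) ⟩
    val d ℚ.+ x                                ≡⟨ cong (ℚ._+ x) (ℚ.*-identityʳ (val d)) ⟨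
    val d ℚ.* 1ℚ ℚ.+ x                         ≤⟨ ℚ.+-monoˡ-≤ x (ℚ.*-monoˡ-≤-nonNeg (val d) {{ℚ.pos⇒nonNeg (val d) {{val-positive d}}}} (s^n≥1 n)) ⟩
    val d ℚ.* x ℚ.+ x                          ≡⟨ cong (val d ℚ.* x ℚ.+_) (ℚ.*-identityˡ x) ⟨
    val d ℚ.* x ℚ.+ 1ℚ ℚ.* x                   ≡⟨ ℚ.*-distribʳ-+ x (val d) 1ℚ ⟨
    (val d ℚ.+ 1ℚ) ℚ.* x                       ≡⟨ cong (ℚ._* x) (trans (ℚ.+-comm (val d) 1ℚ) 1+d≡s) ⟩
    val s ℚ.* x                                ≡⟨ val-*⁺ s (s ^⁺ n) ⟨
    val (s ^⁺ suc n)                           ∎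
    where
    open ℚ.≤-Reasoning
    x : ℚ
    x = val (s ^⁺ n)

  n : ℕ
  n = proj₁ (archimedean (val (q *⁺ inv⁺ d)))

  q<nd : val q ℚ.< natℚ n ℚ.* val d
  q<nd = subst (ℚ._< natℚ n ℚ.* val d) (trans (sym (val-*⁺ (q *⁺ inv⁺ d) d)) (cong val ([p*r⁻¹]*r≡p q d)))
    (ℚ.*-monoˡ-<-pos (val d) {{val-positive d}} (proj₂ (archimedean (val (q *⁺ inv⁺ d)))))

-- Two-sided (located) Dedekind cuts in the positive rationals.  Lower may be
-- empty, which is the real number 0.  Every quantity occurring below is
-- nonnegative, so signed reals are not needed.

record ℝ≥0 : Set₁ where
  field
    Lower Upper     : ℚ⁺ → Set
    lower-down      : ∀ {p q} → p <⁺ q → Lower q → Lower p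
    lower-open      : ∀ {p} → Lower p → ∃ λ q → (p <⁺ q) × Lower q
    upper-up        : ∀ {p q} → p <⁺ q → Upper p → Upper q
    upper-open      : ∀ {q} → Upper q → ∃ λ p → (p <⁺ q) × Upper p
    upper-inhabited : ∃ Upper
    disjoint        : ∀ {q} → Lower q → Upper q → ⊥
    located         : ∀ {p q} → p <⁺ q → Lower p ⊎ Upper q

open ℝ≥0 public

infix 4 _≤ᴿ_

_≤ᴿ_ : ℝ≥0 → ℝ≥0 → Set
x ≤ᴿ y = ∀ q → Lower x q → Lower y q

Positive : ℝ≥0 → Set
Positive x = ∃ (Lower x)

fromℚ : (r : ℚ) → .{{ℚ.NonNegative r}} → ℝ≥0
fromℚ r = record
  { Lower           = λ q → val q ℚ.< r
  ; Upper           = λ q → r ℚ.< val q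
  ; lower-down      = λ p<q q<r → ℚ.<-trans (un<⁺ p<q) q<r
  ; lower-open      = lower-open′
  ; upper-up        = λ p<q r<p → ℚ.<-trans r<p (un<⁺ p<q)
  ; upper-open      = upper-open′
  ; upper-inhabited = above
  ; disjoint        = λ q<r r<q → ℚ.<-asym q<r r<q
  ; located         = located′
  }
  where
  lower-open′ : ∀ {p : ℚ⁺} → val p ℚ.< r → ∃ λ q → (p <⁺ q) × (val q ℚ.< r)
  lower-open′ {p} p<r with ℚ.<-dense p<r
  ... | m , p<m , m<r = ⟨ m ⟩ {{ℚ.positive (ℚ.<-trans (val>0 p) p<m)}} , mk<⁺ p<m , m<r

  upper-open′ : ∀ {q : ℚ⁺} → r ℚ.< val q → ∃ λ p → (p <⁺ q) × (r ℚ.< val p)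
  upper-open′ r<q with ℚ.<-dense r<q
  ... | m , r<m , m<q = ⟨ m ⟩ {{ℚ.positive (ℚ.≤-<-trans (ℚ.nonNegative⁻¹ r) r<m)}} , mk<⁺ m<q , r<m

  above : ∃ λ (q : ℚ⁺) → r ℚ.< val q
  above with archimedean r
  ... | n , r<n = ⟨ natℚ n ⟩ {{ℚ.positive (ℚ.≤-<-trans (ℚ.nonNegative⁻¹ r) r<n)}} , r<n

  located′ : ∀ {p q : ℚ⁺} → p <⁺ q → (val p ℚ.< r) ⊎ (r ℚ.< val q)
  located′ {p} {q} (mk<⁺ p<q) with ℚ.<-cmp (val p) r
  ... | tri< p<r _ _ = inj₁ p<r
  ... | tri≈ _ p≡r _ = inj₂ (subst (ℚ._< val q) p≡r p<q)
  ... | tri> _ _ r<p = inj₂ (ℚ.<-trans r<p p<q)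

fromℕ : ℕ → ℝ≥0
fromℕ n = fromℚ (natℚ n) {{natℚ-nonNegative n}}

lower<upper : ∀ x {p q} → Lower x p → Upper x q → p <⁺ q
lower<upper x {p} {q} Lp Uq with ℚ.<-cmp (val p) (val q)
... | tri< p<q _ _ = mk<⁺ p<q
... | tri≈ _ p≡q _ = contradiction (subst (Upper x) (sym (val-injective p≡q)) Uq) (disjoint x Lp)
... | tri> _ _ q<p = contradiction (upper-up x (mk<⁺ q<p) Uq) (disjoint x Lp)

enclose : ∀ x {ε r} → Lower x ε → 1⁺ <⁺ r →
  ∃ λ a → ∃ λ b → Lower x a × Upper x b × (b <⁺ a *⁺ r)
enclose x {ε} {r} Lε 1<r with sqrt-below 1<r
... | s , 1<s , s²<r = search n ε Lε (upper-up x u<εsⁿ (proj₂ (upper-inhabited x)))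
  where
  u : ℚ⁺
  u = proj₁ (upper-inhabited x)
  n : ℕ
  n = proj₁ (powers-unbounded 1<s (u *⁺ inv⁺ ε))
  u<εsⁿ : u <⁺ ε *⁺ s ^⁺ n
  u<εsⁿ = subst₂ _<⁺_ ([p*r⁻¹]*r≡p u ε) (*⁺-comm (s ^⁺ n) ε)
    (*⁺-monoˡ ε (proj₂ (powers-unbounded 1<s (u *⁺ inv⁺ ε))))

  search : ∀ n a → Lower x a → Upper x (a *⁺ s ^⁺ n) →
    ∃ λ a → ∃ λ b → Lower x a × Upper x b × (b <⁺ a *⁺ r)
  search zero    a La U = contradiction (subst (Upper x) (*⁺-identityʳ a) U) (disjoint x La)
  search (suc n) a La U with located x (p<p*s (a *⁺ s) 1<s)
  ... | inj₁ Las  = search n (a *⁺ s) Las (subst (Upper x) (sym (*⁺-assoc a s (s ^⁺ n))) U)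
  ... | inj₂ Uass = a , (a *⁺ s) *⁺ s , La , Uass ,
        subst (_<⁺ a *⁺ r) (sym (*⁺-assoc a s s)) (*⁺-monoʳ a s²<r)

infixl 7 _*ᴿ_

_*ᴿ_ : ℝ≥0 → ℝ≥0 → ℝ≥0
x *ᴿ y = record
  { Lower           = L
  ; Upper           = U
  ; lower-down      = λ { {p} {q} p<q (a , b , La , Lb , q≡ab) →
      a , p *⁺ inv⁺ a , La
        , lower-down y (subst (p *⁺ inv⁺ a <⁺_) (q/a q≡ab) (*⁺-monoˡ (inv⁺ a) p<q)) Lb
        , sym (a*[p/a] a p) }
  ; lower-open      = λ { {p} (a , b , La , Lb , p≡ab) →
      let (b′ , b<b′ , Lb′) = lower-open y Lb in
      a *⁺ b′ , subst (_<⁺ a *⁺ b′) (sym p≡ab) (*⁺-monoʳ a b<b′) , a , b′ , La , Lb′ , refl }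
  ; upper-up        = λ { {p} {q} p<q (a , b , Ua , Ub , p≡ab) →
      a , q *⁺ inv⁺ a , Ua
        , upper-up y (subst (_<⁺ q *⁺ inv⁺ a) (q/a p≡ab) (*⁺-monoˡ (inv⁺ a) p<q)) Ub
        , sym (a*[p/a] a q) }
  ; upper-open      = λ { {q} (a , b , Ua , Ub , q≡ab) →
      let (b′ , b′<b , Ub′) = upper-open y Ub in
      a *⁺ b′ , subst (a *⁺ b′ <⁺_) (sym q≡ab) (*⁺-monoʳ a b′<b) , a , b′ , Ua , Ub′ , refl }
  ; upper-inhabited =
      let (u , Uu) = upper-inhabited x ; (v , Uv) = upper-inhabited y in u *⁺ v , u , v , Uu , Uv , refl
  ; disjoint        = λ { (a , b , La , Lb , q≡ab) (a′ , b′ , Ua′ , Ub′ , q≡a′b′) →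
      ℚ.<-irrefl (cong val (trans (sym q≡ab) q≡a′b′))
        (un<⁺ (*⁺-mono (lower<upper x La Ua′) (lower<upper y Lb Ub′))) }
  ; located         = located′
  }
  where
  L U : ℚ⁺ → Set
  L q = ∃ λ a → ∃ λ b → Lower x a × Lower y b × q ≡ a *⁺ b
  U q = ∃ λ a → ∃ λ b → Upper x a × Upper y b × q ≡ a *⁺ b

  a*[p/a] : ∀ a p → a *⁺ (p *⁺ inv⁺ a) ≡ p
  a*[p/a] a p = trans (*⁺-comm a (p *⁺ inv⁺ a)) ([p*r⁻¹]*r≡p p a)

  q/a : ∀ {q a b} → q ≡ a *⁺ b → q *⁺ inv⁺ a ≡ b
  q/a {q} {a} {b} q≡ab = trans (cong (_*⁺ inv⁺ a) (trans q≡ab (*⁺-comm a b))) ([p*r]*r⁻¹≡p b a)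

  cross : ∀ {p q a b} → b <⁺ a *⁺ (q *⁺ inv⁺ p) → p *⁺ inv⁺ a <⁺ q *⁺ inv⁺ b
  cross {p} {q} {a} {b} b<aq/p = *⁺-cancelʳ (a *⁺ b) (subst₂ _<⁺_
    (sym (trans (sym (*⁺-assoc (p *⁺ inv⁺ a) a b)) (cong (_*⁺ b) ([p*r⁻¹]*r≡p p a))))
    (sym (trans (cong ((q *⁺ inv⁺ b) *⁺_) (*⁺-comm a b))
         (trans (sym (*⁺-assoc (q *⁺ inv⁺ b) b a)) (cong (_*⁺ a) ([p*r⁻¹]*r≡p q b)))))
    pb<qa)
    where
    pb<qa : p *⁺ b <⁺ q *⁺ a
    pb<qa = subst₂ _<⁺_ (*⁺-comm b p)
      (trans (*⁺-assoc a (q *⁺ inv⁺ p) p) (trans (cong (a *⁺_) ([p*r⁻¹]*r≡p q p)) (*⁺-comm a q)))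
      (*⁺-monoˡ p b<aq/p)

  located′ : ∀ {p q} → p <⁺ q → L p ⊎ U q
  located′ {p} {q} p<q = coarse (upper-inhabited y)
    where
    fine : ∀ a b → Lower x a → Upper x b → Lower y (p *⁺ inv⁺ a) ⊎ Upper y (q *⁺ inv⁺ b) → L p ⊎ U q
    fine a b La Ub (inj₁ Lp/a) = inj₁ (a , p *⁺ inv⁺ a , La , Lp/a , sym (a*[p/a] a p))
    fine a b La Ub (inj₂ Uq/b) = inj₂ (b , q *⁺ inv⁺ b , Ub , Uq/b , sym (a*[p/a] b q))

    medium : ∀ v → Upper y v → Lower x (p *⁺ inv⁺ v) ⊎ Upper x (q *⁺ inv⁺ v) → L p ⊎ U q
    medium v Uv (inj₂ Uq/v) = inj₂ (q *⁺ inv⁺ v , v , Uq/v , Uv , sym ([p*r⁻¹]*r≡p q v))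
    medium v Uv (inj₁ Lp/v) =
      let (a , b , La , Ub , b<aq/p) = enclose x Lp/v (1<q/p p<q)
      in fine a b La Ub (located y (cross b<aq/p))

    coarse : ∃ (Upper y) → L p ⊎ U q
    coarse (v , Uv) = medium v Uv (located x (*⁺-monoˡ (inv⁺ v) p<q))

inverse : (x : ℝ≥0) → Positive x → ℝ≥0
inverse x (l , Ll) = record
  { Lower           = λ q → Upper x (inv⁺ q)
  ; Upper           = λ q → Lower x (inv⁺ q)
  ; lower-down      = λ {p} {q} p<q → upper-up x (inv⁺-antitone p<q)
  ; lower-open      = λ {p} U → let (r , r<p⁻¹ , Ur) = upper-open x U in
      inv⁺ r , subst (_<⁺ inv⁺ r) (inv⁺-involutive p) (inv⁺-antitone r<p⁻¹)
             , subst (Upper x) (sym (inv⁺-involutive r)) Ur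
  ; upper-up        = λ {p} {q} p<q → lower-down x (inv⁺-antitone p<q)
  ; upper-open      = λ {q} L → let (r , q⁻¹<r , Lr) = lower-open x L in
      inv⁺ r , subst (inv⁺ r <⁺_) (inv⁺-involutive q) (inv⁺-antitone q⁻¹<r)
             , subst (Lower x) (sym (inv⁺-involutive r)) Lr
  ; upper-inhabited = inv⁺ l , subst (Lower x) (sym (inv⁺-involutive l)) Ll
  ; disjoint        = λ U L → disjoint x L U
  ; located         = λ {p} {q} p<q → swap (located x (inv⁺-antitone p<q))
  }
  where
  swap : ∀ {P Q : Set} → P ⊎ Q → Q ⊎ P
  swap (inj₁ p) = inj₂ p
  swap (inj₂ q) = inj₁ q

infixl 7 _/ᴿ_[_]

_/ᴿ_[_] : ℝ≥0 → (y : ℝ≥0) → Positive y → ℝ≥0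
x /ᴿ y [ y>0 ] = x *ᴿ inverse y y>0

infix 8 √_

√_ : ℝ≥0 → ℝ≥0
√ x = record
  { Lower           = λ q → Lower x (q *⁺ q)
  ; Upper           = λ q → Upper x (q *⁺ q)
  ; lower-down      = λ {p} {q} p<q → lower-down x (*⁺-mono p<q p<q)
  ; lower-open      = lower-open′
  ; upper-up        = λ {p} {q} p<q → upper-up x (*⁺-mono p<q p<q)
  ; upper-open      = upper-open′
  ; upper-inhabited = upper-inhabited′
  ; disjoint        = disjoint x
  ; located         = λ {p} {q} p<q → located x (*⁺-mono p<q p<q)
  }
  where
  lower-open′ : ∀ {p} → Lower x (p *⁺ p) → ∃ λ q → (p <⁺ q) × Lower x (q *⁺ q)
  lower-open′ {p} L with lower-open x L
  ... | z , p²<z , Lz with sqrt-below (1<q/p p²<z)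
  ...   | s , 1<s , s²<z/p² = p *⁺ s , p<p*s p 1<s , lower-down x
      (subst₂ _<⁺_ (trans (*⁺-comm (s *⁺ s) (p *⁺ p)) (*⁺-interchange p p s s)) ([p*r⁻¹]*r≡p z (p *⁺ p))
        (*⁺-monoˡ (p *⁺ p) s²<z/p²)) Lz

  upper-open′ : ∀ {q} → Upper x (q *⁺ q) → ∃ λ p → (p <⁺ q) × Upper x (p *⁺ p)
  upper-open′ {q} U with upper-open x U
  ... | z , z<q² , Uz with sqrt-below (1<q/p z<q²)
  ...   | s , 1<s , s²<q²/z = p , p<q , upper-up x z<p² Uz
    where
    p : ℚ⁺
    p = q *⁺ inv⁺ s
    p<q : p <⁺ q
    p<q = subst (p <⁺_) ([p*r⁻¹]*r≡p q s) (p<p*s p 1<s)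
    z<p² : z <⁺ p *⁺ p
    z<p² = *⁺-cancelʳ (s *⁺ s) {z} {p *⁺ p} (subst₂ _<⁺_ (*⁺-comm (s *⁺ s) z)
      (trans ([p*r⁻¹]*r≡p (q *⁺ q) z)
        (sym (trans (*⁺-interchange p p s s) (cong₂ _*⁺_ ([p*r⁻¹]*r≡p q s) ([p*r⁻¹]*r≡p q s)))))
      (*⁺-monoˡ z s²<q²/z))

  upper-inhabited′ : ∃ λ q → Upper x (q *⁺ q)
  upper-inhabited′ with upper-inhabited x
  ... | u , Uu with ℚ.<-cmp (val u) 1ℚ
  ...   | tri< u<1 _ _ = 1⁺ , subst (Upper x) (sym (*⁺-identityʳ 1⁺)) (upper-up x (mk<⁺ u<1) Uu)
  ...   | tri≈ _ u≡1 _ = 1⁺ , subst (Upper x) (trans (val-injective u≡1) (sym (*⁺-identityʳ 1⁺))) Uu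
  ...   | tri> _ _ 1<u = u , upper-up x (p<p*s u (mk<⁺ 1<u)) Uu

harmonic : (a N : ℕ) → .{{NonZero a}} → ℚ
harmonic a zero    = 0ℚ
harmonic a (suc N) = + 1 ℚ./ a ℚ.+ harmonic (suc a) N

harmonic-cong : ∀ {a b} N .{{_ : NonZero a}} .{{_ : NonZero b}} → a ≡ b → harmonic a N ≡ harmonic b N
harmonic-cong N refl = refl

harmonic-split : ∀ a k N .{{_ : NonZero a}} .{{_ : NonZero (a ℕ.+ k)}} →
  harmonic a (k ℕ.+ N) ≡ harmonic a k ℚ.+ harmonic (a ℕ.+ k) N
harmonic-split a zero    N = trans (harmonic-cong N (sym (ℕ.+-identityʳ a))) (sym (ℚ.+-identityˡ (harmonic (a ℕ.+ 0) N)))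
harmonic-split a (suc k) N = trans (cong (+ 1 ℚ./ a ℚ.+_)
    (trans (harmonic-split (suc a) k N)
      (cong (harmonic (suc a) k ℚ.+_) (harmonic-cong N (sym (ℕ.+-suc a k))))))
  (sym (ℚ.+-assoc (+ 1 ℚ./ a) (harmonic (suc a) k) (harmonic (a ℕ.+ suc k) N)))

harmonic-nonNegative : ∀ a N .{{_ : NonZero a}} → 0ℚ ℚ.≤ harmonic a N
harmonic-nonNegative a zero    = ℚ.≤-refl
harmonic-nonNegative a (suc N) = ℚ.+-mono-≤
  (ℚ.nonNegative⁻¹ (+ 1 ℚ./ a) {{ℚ.normalize-nonNeg 1 a}}) (harmonic-nonNegative (suc a) N)

harmonic-antitone : ∀ a N .{{_ : NonZero a}} → harmonic (suc a) N ℚ.≤ harmonic a N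
harmonic-antitone a zero    = ℚ.≤-refl
harmonic-antitone a (suc N) =
  ℚ.+-mono-≤ (unitFraction-antitone a (suc a) (ℕ.n≤1+n a)) (harmonic-antitone (suc a) N)

harmonic-telescope : ∀ a N .{{_ : NonZero a}} → harmonic a N ℚ.≤ + 1 ℚ./ a ℚ.+ harmonic (suc a) N
harmonic-telescope a zero    = ℚ.≤-trans
  (ℚ.nonNegative⁻¹ (+ 1 ℚ./ a) {{ℚ.normalize-nonNeg 1 a}})
  (ℚ.≤-reflexive (sym (ℚ.+-identityʳ (+ 1 ℚ./ a))))
harmonic-telescope a (suc N) = ℚ.+-monoʳ-≤ (+ 1 ℚ./ a) (harmonic-telescope (suc a) N)

harmonic-≥ : ∀ b k D .{{_ : NonZero b}} .{{_ : NonZero D}} →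
  b ℕ.+ k ℕ.≤ suc D → natℚ k ℚ.* (+ 1 ℚ./ D) ℚ.≤ harmonic b k
harmonic-≥ b zero    D _ = ℚ.≤-reflexive (ℚ.*-zeroˡ (+ 1 ℚ./ D))
harmonic-≥ b (suc k) D b+k≤D = ℚ.≤-trans (ℚ.≤-reflexive (natℚ-suc-* k (+ 1 ℚ./ D)))
  (ℚ.+-mono-≤
    (unitFraction-antitone b D (ℕ.≤-trans (ℕ.m≤m+n b k) (ℕ.≤-pred 1+b+k≤D)))
    (harmonic-≥ (suc b) k D 1+b+k≤D))
  where
  1+b+k≤D : suc (b ℕ.+ k) ℕ.≤ suc D
  1+b+k≤D = subst (ℕ._≤ suc D) (ℕ.+-suc b k) b+k≤D

harmonic-≤ : ∀ b k D .{{_ : NonZero b}} .{{_ : NonZero D}} →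
  D ℕ.≤ b → harmonic b k ℚ.≤ natℚ k ℚ.* (+ 1 ℚ./ D)
harmonic-≤ b zero    D _   = ℚ.≤-reflexive (sym (ℚ.*-zeroˡ (+ 1 ℚ./ D)))
harmonic-≤ b (suc k) D D≤b = ℚ.≤-trans
  (ℚ.+-mono-≤ (unitFraction-antitone D b D≤b) (harmonic-≤ (suc b) k D (ℕ.m≤n⇒m≤1+n D≤b)))
  (ℚ.≤-reflexive (sym (natℚ-suc-* k (+ 1 ℚ./ D))))

refine-lower : ∀ a k N .{{_ : NonZero k}} → harmonic (suc a) N ℚ.≤ harmonic (suc (a ℕ.* k)) (N ℕ.* k)
refine-lower a k zero    = ℚ.≤-refl
refine-lower a k@(suc _) (suc N) = ℚ.≤-trans
  (ℚ.+-mono-≤ block (refine-lower (suc a) k N))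
  (ℚ.≤-reflexive (sym (trans (harmonic-split (suc (a ℕ.* k)) k (N ℕ.* k))
    (cong (harmonic (suc (a ℕ.* k)) k ℚ.+_) (harmonic-cong (N ℕ.* k) (cong suc (ℕ.+-comm (a ℕ.* k) k)))))))
  where
  block : + 1 ℚ./ suc a ℚ.≤ harmonic (suc (a ℕ.* k)) k
  block = ℚ.≤-trans (ℚ.≤-reflexive (sym (unitFraction-refine (suc a) k)))
    (harmonic-≥ (suc (a ℕ.* k)) k (suc a ℕ.* k) (ℕ.≤-reflexive (cong suc (ℕ.+-comm (a ℕ.* k) k))))

refine-upper : ∀ a k N .{{_ : NonZero a}} .{{_ : NonZero k}} .{{_ : NonZero (a ℕ.* k)}} →
  harmonic (a ℕ.* k) (N ℕ.* k) ℚ.≤ harmonic a N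
refine-upper a k zero    = ℚ.≤-refl
refine-upper a@(suc _) k@(suc _) (suc N) = ℚ.≤-trans
  (ℚ.≤-reflexive (trans (harmonic-split (a ℕ.* k) k (N ℕ.* k))
    (cong (harmonic (a ℕ.* k) k ℚ.+_) (harmonic-cong (N ℕ.* k) (ℕ.+-comm (a ℕ.* k) k)))))
  (ℚ.+-mono-≤ block (refine-upper (suc a) k N))
  where
  block : harmonic (a ℕ.* k) k ℚ.≤ + 1 ℚ./ a
  block = ℚ.≤-trans (harmonic-≤ (a ℕ.* k) k (a ℕ.* k) ℕ.≤-refl) (ℚ.≤-reflexive (unitFraction-refine a k))

-- log n = ∫₁ⁿ dt/t.  Dividing [1 , n] into steps of length 1/m, with
-- m = suc M, the right (left) endpoints give the lower (upper) Riemann sum: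
--   lowerSum n M = ∑ 1/k over m < k ≤ mn,
--   upperSum n M = ∑ 1/k over m ≤ k < mn.
-- Since n ∸ 1 = 0 for n = 0, the value at 0 is the junk value log 0 = 0.

lowerSum upperSum : ℕ → ℕ → ℚ
lowerSum n M = harmonic (suc (suc M)) ((n ℕ.∸ 1) ℕ.* suc M)
upperSum n M = harmonic (suc M)       ((n ℕ.∸ 1) ℕ.* suc M)

lowerSum≤upperSum : ∀ n M M′ → lowerSum n M ℚ.≤ upperSum n M′
lowerSum≤upperSum n M M′ = begin
  harmonic (suc m) (d ℕ.* m)                     ≤⟨ refine-lower m m′ (d ℕ.* m) ⟩
  harmonic (suc (m ℕ.* m′)) ((d ℕ.* m) ℕ.* m′)   ≤⟨ harmonic-antitone (m ℕ.* m′) ((d ℕ.* m) ℕ.* m′) ⟩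
  harmonic (m ℕ.* m′) ((d ℕ.* m) ℕ.* m′)         ≡⟨ harmonic-cong ((d ℕ.* m) ℕ.* m′) (ℕ.*-comm m m′) ⟩
  harmonic (m′ ℕ.* m) ((d ℕ.* m) ℕ.* m′)         ≡⟨ cong (λ N → harmonic (m′ ℕ.* m) N) dmm′≡dm′m ⟩
  harmonic (m′ ℕ.* m) ((d ℕ.* m′) ℕ.* m)         ≤⟨ refine-upper m′ m (d ℕ.* m′) ⟩
  harmonic m′ (d ℕ.* m′)                         ∎
  where
  open ℚ.≤-Reasoning
  d m m′ : ℕ
  d  = n ℕ.∸ 1
  m  = suc M
  m′ = suc M′
  dmm′≡dm′m : (d ℕ.* m) ℕ.* m′ ≡ (d ℕ.* m′) ℕ.* m
  dmm′≡dm′m = trans (ℕ.*-assoc d m m′) (trans (cong (d ℕ.*_) (ℕ.*-comm m m′)) (sym (ℕ.*-assoc d m′ m)))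

log : ℕ → ℝ≥0
log n = record
  { Lower           = L
  ; Upper           = U
  ; lower-down      = λ p<q (M , q<l) → M , ℚ.<-trans (un<⁺ p<q) q<l
  ; lower-open      = lower-open′
  ; upper-up        = λ p<q (M , u<p) → M , ℚ.<-trans u<p (un<⁺ p<q)
  ; upper-open      = upper-open′
  ; upper-inhabited = upper-inhabited′
  ; disjoint        = λ (M , q<l) (M′ , u<q) →
      ℚ.<-irrefl refl (ℚ.<-trans (ℚ.<-≤-trans q<l (lowerSum≤upperSum n M M′)) u<q)
  ; located         = located′
  }
  where
  L U : ℚ⁺ → Set
  L q = ∃ λ M → val q ℚ.< lowerSum n M
  U q = ∃ λ M → upperSum n M ℚ.< val q

  upperSum≥0 : ∀ M → 0ℚ ℚ.≤ upperSum n M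
  upperSum≥0 M = harmonic-nonNegative (suc M) ((n ℕ.∸ 1) ℕ.* suc M)

  lower-open′ : ∀ {p} → L p → ∃ λ q → (p <⁺ q) × L q
  lower-open′ {p} (M , p<l) with ℚ.<-dense p<l
  ... | r , p<r , r<l =
    ⟨ r ⟩ {{ℚ.positive (ℚ.<-trans (val>0 p) p<r)}} , mk<⁺ p<r , M , r<l

  upper-open′ : ∀ {q} → U q → ∃ λ p → (p <⁺ q) × U p
  upper-open′ (M , u<q) with ℚ.<-dense u<q
  ... | r , u<r , r<q = ⟨ r ⟩ {{ℚ.positive (ℚ.≤-<-trans (upperSum≥0 M) u<r)}} , mk<⁺ r<q , M , u<r

  upper-inhabited′ : ∃ U
  upper-inhabited′ with archimedean (upperSum n 0)
  ... | r , u<r = ⟨ natℚ r ⟩ {{ℚ.positive (ℚ.≤-<-trans (upperSum≥0 0) u<r)}} , 0 , u<r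

  located′ : ∀ {p q} → p <⁺ q → L p ⊎ U q
  located′ {p} {q} (mk<⁺ p<q) with unitFraction-small (val q ℚ.- val p) {{p-q-positive p<q}}
  ... | M , 1/m<q-p with val p ℚ.<? lowerSum n M
  ...   | yes p<l = inj₁ (M , p<l)
  ...   | no  p≮l = inj₂ (M , (begin-strict
          upperSum n M                       ≤⟨ harmonic-telescope (suc M) ((n ℕ.∸ 1) ℕ.* suc M) ⟩
          + 1 ℚ./ suc M ℚ.+ lowerSum n M     ≤⟨ ℚ.+-monoʳ-≤ (+ 1 ℚ./ suc M) (ℚ.≮⇒≥ p≮l) ⟩
          + 1 ℚ./ suc M ℚ.+ val p            <⟨ ℚ.+-monoˡ-< (val p) 1/m<q-p ⟩
          val q ℚ.- val p ℚ.+ val p          ≡⟨ ℚ.+-comm (val q ℚ.- val p) (val p) ⟩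
          val p ℚ.+ (val q ℚ.- val p)        ≡⟨ p+[q-p]≡q (val p) (val q) ⟩
          val q                              ∎))
    where open ℚ.≤-Reasoning

log-positive : ∀ {n} → 2 ℕ.≤ n → Positive (log n)
log-positive {suc zero}    (ℕ.s≤s ())
log-positive {suc (suc n)} _ = ⟨ + 1 ℚ./ 4 ⟩ , 0 , ℚ.<-≤-trans 1/4<1/2 1/2≤lowerSum
  where
  1/4<1/2 : + 1 ℚ./ 4 ℚ.< + 1 ℚ./ 2
  1/4<1/2 = ℚ.*<* (+<+ (ℕ.s≤s (ℕ.s≤s (ℕ.s≤s ℕ.z≤n))))
  1/2≤lowerSum : + 1 ℚ./ 2 ℚ.≤ lowerSum (suc (suc n)) 0
  1/2≤lowerSum = ℚ.≤-trans (ℚ.≤-reflexive (sym (ℚ.+-identityʳ (+ 1 ℚ./ 2))))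
    (ℚ.+-monoʳ-≤ (+ 1 ℚ./ 2) (harmonic-nonNegative 3 (n ℕ.* 1)))

{-# OPTIONS --safe #-}
module Submission where

-- Upper bound.  Let T ⊆ {0, …, M} with T + T = {0, …, 2M}, and let A = {0, 1} ∪ (N + T)
-- with N large.  Then hA is the union of the sets jN + {0, …, h − j} + jT, and all of them
-- except the one with j = 1 depend only on M.  The exceptional one has h + ∑ min(h, w)
-- elements, where w runs over the gaps of T.  As min(h, w) has second difference −1 at
-- w = h and 0 elsewhere, giving A two gaps j, j and B two gaps j − 1, j + 1, or vice versa,
-- prescribes the sign of |jA| − |jB| and affects no other sign.
--
-- Lower bound.  For A = {a₁, …, aₖ} and h ≤ H, |hA| depends only on which linear forms with
-- coefficients in {−H, …, H} vanish at (a₁, …, aₖ).  A family of m forms in k variables has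
-- at most (m + 1)ᵏ zero patterns, by elimination of one variable at a time, so that
-- 2ᴴ ≤ (((2H + 1)ᵏ + 1)ᵏ + 1)².

open import Data.Bool using (Bool; true; _∧_)
open import Data.Fin using (Fin; zero; suc; toℕ; combine; funToFin; finToFun)
import Data.Fin.Properties as Fin
open import Data.Integer as ℤ using (ℤ; 0ℤ; +≤+; +<+)
import Data.Integer.Properties as ℤ
import Data.Integer.Tactic.RingSolver as ℤ
open import Data.List using (List; []; _∷_; _++_; length; map; concatMap; filter; deduplicate; replicate;
  upTo; cartesianProductWith; lookup)
import Data.List.Properties as List
open import Data.List.Membership.Propositional using (_∈_; find; lose)
import Data.List.Membership.Propositional.Properties as Mem
open import Data.List.Membership.Propositional.Properties.WithK using (unique∧set⇒bag)
open import Data.List.Relation.Binary.BagAndSetEquality using (∼bag⇒↭)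
open import Data.List.Relation.Binary.Disjoint.Propositional using (Disjoint)
open import Data.List.Relation.Binary.Permutation.Propositional.Properties using (↭-length)
open import Data.List.Relation.Binary.Permutation.Propositional.Properties.WithK using (dedup-++-↭)
open import Data.List.Relation.Binary.Subset.Propositional using (_⊆_)
open import Data.List.Relation.Unary.All as All using (All; []; _∷_)
import Data.List.Relation.Unary.All.Properties as All
open import Data.List.Relation.Unary.Any as Any using (any?; here; there)
import Data.List.Relation.Unary.Any.Properties as Any
open import Data.List.Relation.Unary.Unique.DecPropositional.Properties ℤ._≟_ using (deduplicate-!)
open import Data.List.Relation.Unary.Unique.Propositional using (Unique)
import Data.List.Relation.Unary.Unique.Propositional.Properties as Unique
open import Data.Nat as ℕ using (ℕ; zero; suc; _+_; _*_; _∸_; _^_; _⊓_; _≤_; _<_; z≤n; s≤s; z<s; NonZero)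
open import Data.Nat.ListAction using (sum)
import Data.Nat.ListAction.Properties as ℕ
import Data.Nat.Properties as ℕ
open import Data.Nat.Properties using (<⇒≤)
import Data.Nat.Tactic.RingSolver as ℕ
open import Data.Product using (∃; ∃₂; Σ-syntax; _×_; _,_; proj₁; proj₂)
open import Data.Rational as ℚ using (0ℚ; ½)
import Data.Rational.Properties as ℚ
open import Data.Rational.Unnormalised as ℚᵘ using (mkℚᵘ)
import Data.Rational.Unnormalised.Properties as ℚᵘ
open import Data.Sign as Sign using (Sign; opposite)
open import Data.Sum using (inj₁; inj₂)
open import Data.Vec as Vec using (Vec; []; _∷_; head; tail)
open import Data.Vec.Relation.Unary.All as VecAll using ([]; _∷_)
open import Function using (_∘_; id; _⇔_; mk⇔; Equivalence)
open import Relation.Binary.Definitions using (tri<; tri≈; tri>)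
open import Relation.Binary.PropositionalEquality
open import Relation.Nullary using (¬_; yes; no; does; contradiction; ¬?)
open import Relation.Nullary.Decidable using (_×-dec_; does-⇔; dec-true; dec-false)
open import Relation.Unary using (Decidable)
open import Defs

-- Gaps and the explicit construction

-- Duplicate-free lists with the same members are permutations of each other.
∣∣-cong : ∀ {X Y} → X ⊆ Y → Y ⊆ X → ∣ X ∣ ≡ ∣ Y ∣
∣∣-cong {X} {Y} X⊆Y Y⊆X = ↭-length (∼bag⇒↭ (unique∧set⇒bag (deduplicate-! X) (deduplicate-! Y)
  (mk⇔ (dedup X⊆Y) (dedup Y⊆X))))
  where
  dedup : ∀ {X Y} → X ⊆ Y → deduplicate ℤ._≟_ X ⊆ deduplicate ℤ._≟_ Y
  dedup X⊆Y = Mem.∈-deduplicate⁺ ℤ._≟_ ∘ X⊆Y ∘ Mem.∈-deduplicate⁻ ℤ._≟_ _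

∣∣≤length : ∀ X → ∣ X ∣ ≤ length X
∣∣≤length []      = z≤n
∣∣≤length (x ∷ X) = s≤s (ℕ.≤-trans (List.length-filter _ (deduplicate ℤ._≟_ X)) (∣∣≤length X))

Unique⇒∣∣≡length : ∀ {X} → Unique X → ∣ X ∣ ≡ length X
Unique⇒∣∣≡length {X} X! = ↭-length (∼bag⇒↭ (unique∧set⇒bag (deduplicate-! X) X!
  (mk⇔ (Mem.∈-deduplicate⁻ ℤ._≟_ X) (Mem.∈-deduplicate⁺ ℤ._≟_))))

∣∣-++ : ∀ {X Y} → Disjoint X Y → ∣ X ++ Y ∣ ≡ ∣ X ∣ + ∣ Y ∣
∣∣-++ {X} {Y} disj = trans (↭-length (dedup-++-↭ ℤ._≟_ disj)) (List.length-++ (deduplicate ℤ._≟_ X))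

∣∣-split : ∀ {P : ℤ → Set} (P? : Decidable P) X → ∣ X ∣ ≡ ∣ filter P? X ∣ + ∣ filter (¬? ∘ P?) X ∣
∣∣-split P? X = trans (∣∣-cong to from) (∣∣-++ {filter P? X} disj)
  where
  to : X ⊆ filter P? X ++ filter (¬? ∘ P?) X
  to {z} z∈X with P? z
  ... | yes Pz = Mem.∈-++⁺ˡ (Mem.∈-filter⁺ P? z∈X Pz)
  ... | no ¬Pz = Mem.∈-++⁺ʳ (filter P? X) (Mem.∈-filter⁺ (¬? ∘ P?) z∈X ¬Pz)

  from : filter P? X ++ filter (¬? ∘ P?) X ⊆ X
  from z∈ with Mem.∈-++⁻ (filter P? X) z∈
  ... | inj₁ z∈P  = proj₁ (Mem.∈-filter⁻ P? z∈P)
  ... | inj₂ z∈¬P = proj₁ (Mem.∈-filter⁻ (¬? ∘ P?) z∈¬P)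

  disj : Disjoint (filter P? X) (filter (¬? ∘ P?) X)
  disj (z∈P , z∈¬P) = proj₂ (Mem.∈-filter⁻ (¬? ∘ P?) {xs = X} z∈¬P) (proj₂ (Mem.∈-filter⁻ P? {xs = X} z∈P))

-- Sets of naturals given by their gaps

partialSums : List ℕ → List ℕ
partialSums []       = 0 ∷ []
partialSums (v ∷ vs) = 0 ∷ map (v +_) (partialSums vs)

length-partialSums : ∀ vs → length (partialSums vs) ≡ suc (length vs)
length-partialSums []       = refl
length-partialSums (v ∷ vs) = cong suc (trans (List.length-map (v +_) (partialSums vs)) (length-partialSums vs))

0∈partialSums : ∀ vs → 0 ∈ partialSums vs
0∈partialSums []       = here refl
0∈partialSums (v ∷ vs) = here refl

sum∈partialSums : ∀ vs → sum vs ∈ partialSums vs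
sum∈partialSums []       = here refl
sum∈partialSums (v ∷ vs) = there (Mem.∈-map⁺ (v +_) (sum∈partialSums vs))

partialSums≤sum : ∀ vs {t} → t ∈ partialSums vs → t ≤ sum vs
partialSums≤sum []       (here refl) = z≤n
partialSums≤sum (v ∷ vs) (here refl) = z≤n
partialSums≤sum (v ∷ vs) (there t∈) with Mem.∈-map⁻ (v +_) t∈
... | t′ , t′∈ , refl = ℕ.+-monoʳ-≤ v (partialSums≤sum vs t′∈)

∈-partialSums-++⁺ˡ : ∀ us vs {t} → t ∈ partialSums us → t ∈ partialSums (us ++ vs)
∈-partialSums-++⁺ˡ []       vs (here refl) = 0∈partialSums vs
∈-partialSums-++⁺ˡ (u ∷ us) vs (here refl) = here refl
∈-partialSums-++⁺ˡ (u ∷ us) vs (there t∈) with Mem.∈-map⁻ (u +_) t∈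
... | t′ , t′∈ , refl = there (Mem.∈-map⁺ (u +_) (∈-partialSums-++⁺ˡ us vs t′∈))

∈-partialSums-++⁺ʳ : ∀ us vs {t} → t ∈ partialSums vs → sum us + t ∈ partialSums (us ++ vs)
∈-partialSums-++⁺ʳ []       vs t∈ = t∈
∈-partialSums-++⁺ʳ (u ∷ us) vs {t} t∈ = there (subst (_∈ map (u +_) (partialSums (us ++ vs)))
  (sym (ℕ.+-assoc u (sum us) t)) (Mem.∈-map⁺ (u +_) (∈-partialSums-++⁺ʳ us vs t∈)))

∈-partialSums-replicate : ∀ n {t} → t ≤ n → t ∈ partialSums (replicate n 1)
∈-partialSums-replicate zero    z≤n       = here refl
∈-partialSums-replicate (suc n) z≤n       = here refl
∈-partialSums-replicate (suc n) (s≤s t≤n) = there (Mem.∈-map⁺ suc (∈-partialSums-replicate n t≤n))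

-- Greedy descent: gaps shorter than `s` are subtracted until one is at least as long as the rest,
-- which is then at most `L`. The allowance `+ L` covers the end of the list, where no gap is left
-- to stop the descent.
partialSum-below : ∀ {L} vs → All (_≤ L) vs → ∀ {s} → s ≤ sum vs + L →
  ∃₂ λ t e → t ∈ partialSums vs × e ≤ L × s ≡ t + e
partialSum-below []       []           {s} s≤L = 0 , s , here refl , s≤L , refl
partialSum-below (v ∷ vs) (v≤L ∷ vs≤L) {s} s≤ with s ℕ.≤? v
... | yes s≤v = 0 , s , here refl , ℕ.≤-trans s≤v v≤L , refl
... | no  s≰v with ℕ.m≤n⇒∃[o]m+o≡n (ℕ.≰⇒≥ s≰v)
...   | s′ , refl with partialSum-below vs vs≤L
        (ℕ.+-cancelˡ-≤ v s′ _ (ℕ.≤-trans s≤ (ℕ.≤-reflexive (ℕ.+-assoc v (sum vs) _))))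
...     | t , e , t∈ , e≤L , refl = v + t , e , there (Mem.∈-map⁺ (v +_) t∈) , e≤L , sym (ℕ.+-assoc v t e)

partialSum-above : ∀ {L} vs → All (_≤ L) vs → ∀ {s} → s ≤ sum vs →
  ∃₂ λ t e → t ∈ partialSums vs × e ≤ L × s + e ≡ t
partialSum-above []       []           {zero} z≤n = 0 , 0 , here refl , z≤n , refl
partialSum-above (v ∷ vs) (v≤L ∷ vs≤L) {s} s≤ with s ℕ.≤? v
... | yes s≤v with ℕ.m≤n⇒∃[o]m+o≡n s≤v
...   | e , refl = s + e , e ,
        there (subst (_∈ map (s + e +_) (partialSums vs)) (ℕ.+-identityʳ _)
          (Mem.∈-map⁺ (s + e +_) (0∈partialSums vs))) ,
        ℕ.≤-trans (ℕ.m≤n+m e s) v≤L , refl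
partialSum-above (v ∷ vs) (v≤L ∷ vs≤L) {s} s≤ | no  s≰v with ℕ.m≤n⇒∃[o]m+o≡n (ℕ.≰⇒≥ s≰v)
...   | s′ , refl with partialSum-above vs vs≤L (ℕ.+-cancelˡ-≤ v s′ _ s≤)
...     | t , e , t∈ , e≤L , refl = v + t , e , there (Mem.∈-map⁺ (v +_) t∈) , e≤L , ℕ.+-assoc v s′ e

-- fill h vs enumerates partialSums vs + {0, …, h − 1} without repetition: a gap of
-- length v receives min(h, v) elements.
fill : ℕ → List ℕ → List ℕ
fill h []       = upTo h
fill h (v ∷ vs) = upTo (h ⊓ v) ++ map (v +_) (fill h vs)

length-fill : ∀ h vs → length (fill h vs) ≡ sum (map (h ⊓_) vs) + h
length-fill h []       = List.length-upTo h
length-fill h (v ∷ vs) = begin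
  length (upTo (h ⊓ v) ++ map (v +_) (fill h vs))           ≡⟨ List.length-++ (upTo (h ⊓ v)) ⟩
  length (upTo (h ⊓ v)) + length (map (v +_) (fill h vs))
    ≡⟨ cong₂ _+_ (List.length-upTo (h ⊓ v)) (trans (List.length-map (v +_) (fill h vs)) (length-fill h vs)) ⟩
  h ⊓ v + (sum (map (h ⊓_) vs) + h)                         ≡⟨ ℕ.+-assoc (h ⊓ v) _ h ⟨
  h ⊓ v + sum (map (h ⊓_) vs) + h                           ∎
  where open ≡-Reasoning

fill-! : ∀ h vs → Unique (fill h vs)
fill-! h []       = Unique.upTo⁺ h
fill-! h (v ∷ vs) = Unique.++⁺ (Unique.upTo⁺ (h ⊓ v)) (Unique.map⁺ (ℕ.+-cancelˡ-≡ v _ _) (fill-! h vs)) disj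
  where
  disj : Disjoint (upTo (h ⊓ v)) (map (v +_) (fill h vs))
  disj (n∈ , n∈′) with Mem.∈-map⁻ (v +_) n∈′
  ... | m , _ , refl = ℕ.<⇒≱ (ℕ.<-≤-trans (Mem.∈-upTo⁻ n∈) (ℕ.m⊓n≤n h v)) (ℕ.m≤m+n v m)

∈-fill⁻ : ∀ h vs {n} → n ∈ fill h vs → ∃₂ λ t i → t ∈ partialSums vs × i < h × n ≡ t + i
∈-fill⁻ h []       {n} n∈ = 0 , n , here refl , Mem.∈-upTo⁻ n∈ , refl
∈-fill⁻ h (v ∷ vs) {n} n∈ with Mem.∈-++⁻ (upTo (h ⊓ v)) n∈
... | inj₁ n∈ˡ = 0 , n , here refl , ℕ.<-≤-trans (Mem.∈-upTo⁻ n∈ˡ) (ℕ.m⊓n≤m h v) , refl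
... | inj₂ n∈ʳ with Mem.∈-map⁻ (v +_) n∈ʳ
...   | m , m∈ , refl with ∈-fill⁻ h vs m∈
...     | t , i , t∈ , i<h , refl = v + t , i , there (Mem.∈-map⁺ (v +_) t∈) , i<h , sym (ℕ.+-assoc v t i)

∈-fill⁺ : ∀ h vs {t i} → t ∈ partialSums vs → i < h → t + i ∈ fill h vs
∈-fill⁺ h []       (here refl) i<h = Mem.∈-upTo⁺ i<h
∈-fill⁺ h (v ∷ vs) {i = i} (here refl) i<h with i ℕ.<? v
... | yes i<v = Mem.∈-++⁺ˡ (Mem.∈-upTo⁺ (ℕ.⊓-pres-m< i<h i<v))
-- An offset that overruns the gap is a smaller offset from the next partial sum.
... | no  i≮v with ℕ.m≤n⇒∃[o]m+o≡n (ℕ.≮⇒≥ i≮v)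
...   | i′ , refl = Mem.∈-++⁺ʳ (upTo (h ⊓ v)) (Mem.∈-map⁺ (v +_)
        (∈-fill⁺ h vs (0∈partialSums vs) (ℕ.≤-<-trans (ℕ.m≤n+m i′ v) i<h)))
∈-fill⁺ h (v ∷ vs) {i = i} (there t∈) i<h with Mem.∈-map⁻ (v +_) t∈
... | t′ , t′∈ , refl = Mem.∈-++⁺ʳ (upTo (h ⊓ v)) (subst (_∈ map (v +_) (fill h vs)) (sym (ℕ.+-assoc v t′ i))
        (Mem.∈-map⁺ (v +_) (∈-fill⁺ h vs t′∈ i<h)))

-- The sumset jT as a relation, so that pattern matching can single out the case j = 1.
data Sums (T : List ℕ) : ℕ → ℕ → Set where
  []  : Sums T 0 0
  _∷_ : ∀ {j t s} → t ∈ T → Sums T j s → Sums T (suc j) (t + s)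

Sums-≤ : ∀ {T M} → (∀ {t} → t ∈ T → t ≤ M) → ∀ {j s} → Sums T j s → s ≤ j * M
Sums-≤ T≤M []        = z≤n
Sums-≤ T≤M (t∈ ∷ ss) = ℕ.+-mono-≤ (T≤M t∈) (Sums-≤ T≤M ss)

padded : ℕ → List ℕ → List ℕ
padded L ws = replicate L 1 ++ ws ++ replicate L 1

sum-replicate-1 : ∀ n → sum (replicate n 1) ≡ n
sum-replicate-1 zero    = refl
sum-replicate-1 (suc n) = cong suc (sum-replicate-1 n)

-- The outer blocks {0, …, L} and {M − L, …, M} of T = partialSums (padded L ws) bridge
-- all gaps of T, so that already T + T = {0, …, 2M}.
module _ (L : ℕ) (1≤L : 1 ≤ L) (ws : List ℕ) (ws≤L : All (_≤ L) ws) where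

  private
    T = partialSums (padded L ws)
    M = sum (padded L ws)

    gaps≤L : All (_≤ L) (padded L ws)
    gaps≤L = All.++⁺ (All.replicate⁺ L 1≤L) (All.++⁺ ws≤L (All.replicate⁺ L 1≤L))

    bottom : ∀ {e} → e ≤ L → e ∈ T
    bottom e≤L = ∈-partialSums-++⁺ˡ (replicate L 1) _ (∈-partialSums-replicate L e≤L)

    top : ∀ {e} → e ≤ L → ∃ λ t → t ∈ T × t + e ≡ M
    top {e} e≤L = sum (replicate L 1) + (sum ws + (L ∸ e)) ,
      ∈-partialSums-++⁺ʳ (replicate L 1) _ (∈-partialSums-++⁺ʳ ws _ (∈-partialSums-replicate L (ℕ.m∸n≤m L e))) , (begin
        sum (replicate L 1) + (sum ws + (L ∸ e)) + e     ≡⟨ ℕ.+-assoc (sum (replicate L 1)) _ e ⟩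
        sum (replicate L 1) + (sum ws + (L ∸ e) + e)
          ≡⟨ cong (sum (replicate L 1) +_) (ℕ.+-assoc (sum ws) (L ∸ e) e) ⟩
        sum (replicate L 1) + (sum ws + (L ∸ e + e))
          ≡⟨ cong (λ l → sum (replicate L 1) + (sum ws + l)) (trans (ℕ.m∸n+n≡m e≤L) (sym (sum-replicate-1 L))) ⟩
        sum (replicate L 1) + (sum ws + sum (replicate L 1))
          ≡⟨ cong (sum (replicate L 1) +_) (ℕ.sum-++ ws (replicate L 1)) ⟨
        sum (replicate L 1) + sum (ws ++ replicate L 1)  ≡⟨ ℕ.sum-++ (replicate L 1) _ ⟨
        M                                                ∎)
      where open ≡-Reasoning

  -- For s ≤ M, the distance e ≤ L from a partial sum below s is itself an element of the bottom
  -- block. For s = M + s′, a partial sum s′ + e above s′ is completed by M - e from the top block.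
  Sums-complete₂ : ∀ {s} → s ≤ 2 * M → Sums T 2 s
  Sums-complete₂ {s} s≤2M with s ℕ.≤? M
  ... | yes s≤M with partialSum-below (padded L ws) gaps≤L (ℕ.≤-trans s≤M (ℕ.m≤m+n M L))
  ...   | t , e , t∈ , e≤L , refl = subst (λ e → Sums T 2 (t + e)) (ℕ.+-identityʳ e) (t∈ ∷ bottom e≤L ∷ [])
  Sums-complete₂ {s} s≤2M | no s≰M with ℕ.m≤n⇒∃[o]m+o≡n (ℕ.≰⇒≥ s≰M)
  ... | s′ , refl with partialSum-above (padded L ws) gaps≤L
        (ℕ.+-cancelˡ-≤ M s′ M (ℕ.≤-trans s≤2M (ℕ.≤-reflexive (cong (λ m → M + m) (ℕ.+-identityʳ M)))))
  ...   | t , e , t∈ , e≤L , refl with top e≤L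
  ...     | u , u∈ , u+e≡M = subst (Sums T 2) eq (t∈ ∷ u∈ ∷ [])
    where
    open ≡-Reasoning
    rearrange : ∀ s e u → s + e + (u + 0) ≡ u + e + s
    rearrange = ℕ.solve-∀
    eq : s′ + e + (u + 0) ≡ M + s′
    eq = trans (rearrange s′ e u) (cong (_+ s′) u+e≡M)

  -- As 0 and M both belong to T, each further summand extends the range by M: it is 0 if s was
  -- within reach already, and M otherwise.
  Sums-complete : ∀ j {s} → s ≤ suc (suc j) * M → Sums T (suc (suc j)) s
  Sums-complete zero    s≤ = Sums-complete₂ s≤
  Sums-complete (suc j) {s} s≤ with s ℕ.≤? suc (suc j) * M
  ... | yes s≤′ = 0∈partialSums (padded L ws) ∷ Sums-complete j s≤′
  ... | no  s≰  with ℕ.m≤n⇒∃[o]m+o≡n (ℕ.≤-trans (ℕ.m≤m+n M (suc j * M)) (ℕ.≰⇒≥ s≰))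
  ...   | s′ , refl = sum∈partialSums (padded L ws) ∷ Sums-complete j (ℕ.+-cancelˡ-≤ M s′ _ s≤)

-- The h-fold sumset of the construction

construction : ℕ → List ℕ → List ℤ
construction N T = ℤ.+ 0 ∷ ℤ.+ 1 ∷ map (λ t → ℤ.+ (N + t)) T

-- Here `j` counts the summands from N + T and `i` those equal to 1; the slack in j + i ≤ h is the
-- number of zeros.
∈-·-construction⁻ : ∀ N T h {z} → z ∈ h · construction N T →
  ∃₂ λ j i → ∃ λ s → Sums T j s × j + i ≤ h × z ≡ ℤ.+ (j * N + (i + s))
∈-·-construction⁻ N T zero (here refl) = 0 , 0 , 0 , [] , z≤n , refl
∈-·-construction⁻ N T (suc h) z∈
  with Mem.∈-cartesianProductWith⁻ ℤ._+_ (construction N T) (h · construction N T) z∈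
... | a , b , a∈ , b∈ , refl with ∈-·-construction⁻ N T h b∈
∈-·-construction⁻ N T (suc h) z∈ | _ , _ , here refl , _ , refl | j , i , s , ss , j+i≤h , refl =
  j , i , s , ss , ℕ.m≤n⇒m≤1+n j+i≤h , refl
∈-·-construction⁻ N T (suc h) z∈ | _ , _ , there (here refl) , _ , refl | j , i , s , ss , j+i≤h , refl =
  j , suc i , s , ss , ℕ.≤-trans (ℕ.≤-reflexive (ℕ.+-suc j i)) (s≤s j+i≤h) , cong ℤ.+_ (sym (ℕ.+-suc (j * N) (i + s)))
∈-·-construction⁻ N T (suc h) z∈ | _ , _ , there (there a∈) , _ , refl | j , i , s , ss , j+i≤h , refl
  with Mem.∈-map⁻ (λ t → ℤ.+ (N + t)) a∈
... | t , t∈ , refl = suc j , i , t + s , t∈ ∷ ss , s≤s j+i≤h , cong ℤ.+_ (rearrange N t (j * N) i s)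
  where
  rearrange : ∀ N t jN i s → N + t + (jN + (i + s)) ≡ N + jN + (i + (t + s))
  rearrange = ℕ.solve-∀

-- The summands are laid out in a fixed order: first those from N + T, then the ones, then zeros up
-- to the length h.
∈-·-construction⁺ : ∀ N T h {j i s} → Sums T j s → j + i ≤ h → ℤ.+ (j * N + (i + s)) ∈ h · construction N T
∈-·-construction⁺ N T zero    {i = zero}  []        _         = here refl
∈-·-construction⁺ N T (suc h) {i = zero}  []        _         =
  Mem.∈-cartesianProductWith⁺ ℤ._+_ {construction N T} {h · construction N T} {ℤ.+ 0} {ℤ.+ 0}
    (here refl) (∈-·-construction⁺ N T h [] z≤n)
∈-·-construction⁺ N T (suc h) {i = suc i} []        (s≤s i≤h) =
  Mem.∈-cartesianProductWith⁺ ℤ._+_ {construction N T} {h · construction N T} {ℤ.+ 1} {ℤ.+ (i + 0)}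
    (there (here refl)) (∈-·-construction⁺ N T h [] i≤h)
∈-·-construction⁺ N T (suc h) {suc j} {i} {.(t + s)} (_∷_ {t = t} {s} t∈ ss) (s≤s j+i≤h) =
  subst (_∈ suc h · construction N T) (cong ℤ.+_ (rearrange N t (j * N) i s))
    (Mem.∈-cartesianProductWith⁺ ℤ._+_ {construction N T} {h · construction N T} {ℤ.+ (N + t)} {ℤ.+ (j * N + (i + s))}
      (there (there (Mem.∈-map⁺ (λ t → ℤ.+ (N + t)) t∈))) (∈-·-construction⁺ N T h ss j+i≤h))
  where
  rearrange : ∀ N t jN i s → N + t + (jN + (i + s)) ≡ N + jN + (i + (t + s))
  rearrange = ℕ.solve-∀

module _ (H : ℕ) where

  private
    -- The longest gap to be bridged is H + 1, which occurs in the pair for h = H.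
    L = suc H

  width : List ℕ → ℕ
  width ws = sum (padded L ws)

  -- With M = `width ws` and N = H + M + 1, for h ≤ H the sums with j = 0 are at most H < N, those
  -- with j = 1 lie between N and N + H + M < 2N, and those with j ≥ 2 are at least 2N. So
  -- `InBlock N` isolates j = 1.
  witness : List ℕ → List ℤ
  witness ws = construction (suc (H + width ws)) (partialSums (padded L ws))

  InBlock : ℕ → ℤ → Set
  InBlock N z = N ≤ ℤ.∣ z ∣ × ℤ.∣ z ∣ < N + N

  inBlock? : ∀ N → Decidable (InBlock N)
  inBlock? N z = N ℕ.≤? ℤ.∣ z ∣ ×-dec ℤ.∣ z ∣ ℕ.<? N + N

  -- One summand from N + T leaves h - 1 summands equal to 0 or 1, so the block consists of the N +
  -- t + i with i < h, which `fill h` enumerates up to the shift by N.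
  ∣block∣ : ∀ ws {h} → 1 ≤ h → h ≤ H →
    ∣ filter (inBlock? (suc (H + width ws))) (h · witness ws) ∣ ≡ length (fill h (padded L ws))
  ∣block∣ ws {suc h} _ h<H = begin
    ∣ filter P? (suc h · witness ws) ∣               ≡⟨ ∣∣-cong to from ⟩
    ∣ map embed (fill (suc h) (padded L ws)) ∣
      ≡⟨ Unique⇒∣∣≡length (Unique.map⁺ embed-injective (fill-! (suc h) (padded L ws))) ⟩
    length (map embed (fill (suc h) (padded L ws)))  ≡⟨ List.length-map embed (fill (suc h) (padded L ws)) ⟩
    length (fill (suc h) (padded L ws))              ∎
    where
    open ≡-Reasoning
    M N : ℕ
    M = width ws
    N = suc (H + M)
    T = partialSums (padded L ws)
    P? = inBlock? N

    embed : ℕ → ℤ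
    embed n = ℤ.+ (N + n)

    embed-injective : ∀ {m n} → embed m ≡ embed n → m ≡ n
    embed-injective = ℕ.+-cancelˡ-≡ N _ _ ∘ ℤ.+-injective

    to : filter P? (suc h · witness ws) ⊆ map embed (fill (suc h) (padded L ws))
    to z∈ with Mem.∈-filter⁻ P? {xs = suc h · witness ws} z∈
    ... | z∈hA , N≤z , z<2N with ∈-·-construction⁻ N T (suc h) z∈hA
    ...   | 0 , i , _ , [] , i≤h , refl = contradiction N≤z (ℕ.<⇒≱ (s≤s
              (ℕ.≤-trans (ℕ.≤-reflexive (ℕ.+-identityʳ i)) (ℕ.≤-trans i≤h (ℕ.≤-trans h<H (ℕ.m≤m+n H M))))))
    ...   | suc (suc j) , i , s , _ , _ , refl = contradiction z<2N (ℕ.≤⇒≯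
              (ℕ.≤-trans (ℕ.+-monoʳ-≤ N (ℕ.m≤m+n N (j * N))) (ℕ.m≤m+n (N + (N + j * N)) (i + s))))
    ...   | 1 , i , _ , _∷_ {t = t} t∈ [] , s≤s i≤h , refl = subst (_∈ map embed (fill (suc h) (padded L ws)))
              (cong ℤ.+_ (rearrange N t i)) (Mem.∈-map⁺ embed (∈-fill⁺ (suc h) (padded L ws) t∈ (s≤s i≤h)))
      where
      rearrange : ∀ N t i → N + (t + i) ≡ N + 0 + (i + (t + 0))
      rearrange = ℕ.solve-∀

    from : map embed (fill (suc h) (padded L ws)) ⊆ filter P? (suc h · witness ws)
    from z∈ with Mem.∈-map⁻ embed z∈
    ... | n , n∈ , refl with ∈-fill⁻ (suc h) (padded L ws) n∈
    ...   | t , i , t∈ , s≤s i≤h , refl = Mem.∈-filter⁺ P?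
              (subst (_∈ suc h · witness ws) (cong ℤ.+_ (rearrange N t i))
                (∈-·-construction⁺ N T (suc h) (t∈ ∷ []) (s≤s i≤h)))
              (ℕ.m≤m+n N (t + i) , ℕ.+-monoʳ-< N (s≤s (ℕ.≤-trans (ℕ.≤-reflexive (ℕ.+-comm t i))
                (ℕ.+-mono-≤ (ℕ.≤-trans i≤h (ℕ.<⇒≤ h<H)) (partialSums≤sum (padded L ws) t∈)))))
      where
      rearrange : ∀ N t i → N + 0 + (i + (t + 0)) ≡ N + (t + i)
      rearrange = ℕ.solve-∀

  -- Sums with j = 0 do not involve the gaps, and those with j = 1 lie in the block. For j ≥ 2 the
  -- part from T is at most jM, and `Sums-complete` reaches all such values with the gaps `ws` as
  -- well.
  outside-⊆ : ∀ N us ws → All (_≤ L) ws → width us ≡ width ws → H + width us < N → ∀ {h} → h ≤ H →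
    filter (¬? ∘ inBlock? N) (h · construction N (partialSums (padded L us))) ⊆
    filter (¬? ∘ inBlock? N) (h · construction N (partialSums (padded L ws)))
  outside-⊆ N us ws ws≤L eq H+M<N {h} h≤H z∈
    with Mem.∈-filter⁻ (¬? ∘ inBlock? N) {xs = h · construction N (partialSums (padded L us))} z∈
  ... | z∈hA , z∉block = Mem.∈-filter⁺ (¬? ∘ inBlock? N) (transfer z∈hA z∉block) z∉block
    where
    transfer : ∀ {z} → z ∈ h · construction N (partialSums (padded L us)) → ¬ InBlock N z →
      z ∈ h · construction N (partialSums (padded L ws))
    transfer z∈ z∉block with ∈-·-construction⁻ N (partialSums (padded L us)) h z∈
    ... | 0 , i , _ , [] , i≤h , refl = ∈-·-construction⁺ N _ h [] i≤h
    ... | 1 , i , _ , _∷_ {t = t} t∈ [] , i<h , refl = contradiction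
          ( ℕ.≤-trans (ℕ.m≤m+n N 0) (ℕ.m≤m+n (N + 0) (i + (t + 0)))
          , ℕ.≤-<-trans (ℕ.≤-reflexive (rearrange N t i)) (ℕ.+-monoʳ-< N (ℕ.≤-<-trans
              (ℕ.+-mono-≤ (ℕ.≤-trans (ℕ.<⇒≤ i<h) h≤H) (partialSums≤sum (padded L us) t∈)) H+M<N)))
          z∉block
      where
      rearrange : ∀ N t i → N + 0 + (i + (t + 0)) ≡ N + (i + t)
      rearrange = ℕ.solve-∀
    ... | suc (suc j) , i , s , ss , j+i≤h , refl = ∈-·-construction⁺ N _ h
          (Sums-complete L (s≤s z≤n) ws ws≤L j (subst (λ m → s ≤ suc (suc j) * m) eq
            (Sums-≤ (partialSums≤sum (padded L us)) ss))) j+i≤h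

  remainder : ∀ us → ℕ → ℕ
  remainder us h = ∣ filter (¬? ∘ inBlock? (suc (H + width us))) (h · witness us) ∣

  ∣h·witness∣ : ∀ ws {h} → 1 ≤ h → h ≤ H →
    ∣ h · witness ws ∣ ≡ length (fill h (padded L ws)) + remainder ws h
  ∣h·witness∣ ws {h} 1≤h h≤H = trans (∣∣-split (inBlock? (suc (H + width ws))) (h · witness ws))
    (cong (_+ remainder ws h) (∣block∣ ws 1≤h h≤H))

  remainder-cong : ∀ us ws → All (_≤ L) us → All (_≤ L) ws → width us ≡ width ws → ∀ {h} → h ≤ H →
    remainder us h ≡ remainder ws h
  remainder-cong us ws us≤L ws≤L eq {h} h≤H = trans
    (∣∣-cong (outside-⊆ N us ws ws≤L eq ℕ.≤-refl h≤H)
      (outside-⊆ N ws us us≤L (sym eq) (s≤s (ℕ.≤-reflexive (cong (H +_) (sym eq)))) h≤H))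
    (cong (λ M → ∣ filter (¬? ∘ inBlock? (suc (H + M)))
      (h · construction (suc (H + M)) (partialSums (padded L ws))) ∣) eq)
    where
    N : ℕ
    N = suc (H + width us)

-- Gaps that prescribe the signs

received : ℕ → List ℕ → ℕ
received h ws = sum (map (h ⊓_) ws)

received-++ : ∀ h us ws → received h (us ++ ws) ≡ received h us + received h ws
received-++ h us ws = trans (cong sum (List.map-++ (h ⊓_) us ws)) (ℕ.sum-++ (map (h ⊓_) us) (map (h ⊓_) ws))

-- The pair responsible for h = m + 1. For m = 0 the second form contains the gap 0, which merely
-- repeats a point of T.
pair : Sign → ℕ → List ℕ
pair Sign.+ m = suc m ∷ suc m ∷ []
pair Sign.- m = m ∷ suc (suc m) ∷ []

sum-pair : ∀ s m → sum (pair s m) ≡ suc m + suc m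
sum-pair Sign.+ m = cong (suc m +_) (ℕ.+-identityʳ (suc m))
sum-pair Sign.- m = trans (cong (m +_) (ℕ.+-identityʳ (suc (suc m)))) (ℕ.+-suc m (suc m))

received-pair-below : ∀ s {h m} → h ≤ m → received h (pair s m) ≡ h + h
received-pair-below Sign.+ {h} {m} h≤m rewrite ℕ.m≤n⇒m⊓n≡m (ℕ.m≤n⇒m≤1+n h≤m) = cong (h +_) (ℕ.+-identityʳ h)
received-pair-below Sign.- {h} {m} h≤m rewrite ℕ.m≤n⇒m⊓n≡m h≤m | ℕ.m≤n⇒m⊓n≡m (ℕ.m≤n⇒m≤1+n (ℕ.m≤n⇒m≤1+n h≤m)) =
  cong (h +_) (ℕ.+-identityʳ h)

received-pair-above : ∀ s {h m} → suc (suc m) ≤ h → received h (pair s m) ≡ suc m + suc m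
received-pair-above s {h} {m} 2+m≤h = trans (cong sum (List.map-id-local (All.map ℕ.m≥n⇒m⊓n≡n (≤h s)))) (sum-pair s m)
  where
  ≤h : ∀ s → All (_≤ h) (pair s m)
  ≤h Sign.+ = ℕ.<⇒≤ 2+m≤h ∷ ℕ.<⇒≤ 2+m≤h ∷ []
  ≤h Sign.- = ℕ.<⇒≤ (ℕ.<⇒≤ 2+m≤h) ∷ 2+m≤h ∷ []

-- On {m, m + 1, m + 2} the function min(h, ·) is constant for h ≤ m and the identity for h ≥ m + 2.
-- Either way the two pairs, having equal length and equal sum, receive the same.
received-pair-≢ : ∀ s s′ {h m} → h ≢ suc m → received h (pair s m) ≡ received h (pair s′ m)
received-pair-≢ s s′ {h} {m} h≢1+m with ℕ.≤-total h m
... | inj₁ h≤m = trans (received-pair-below s h≤m) (sym (received-pair-below s′ h≤m))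
... | inj₂ m≤h with ℕ.m≤n⇒m<n∨m≡n m≤h
...   | inj₂ refl = trans (received-pair-below s ℕ.≤-refl) (sym (received-pair-below s′ ℕ.≤-refl))
...   | inj₁ m<h  = trans (received-pair-above s 2+m≤h) (sym (received-pair-above s′ 2+m≤h))
  where
  2+m≤h : suc (suc m) ≤ h
  2+m≤h = ℕ.≤∧≢⇒< m<h (h≢1+m ∘ sym)

-- The gap m + 2 is cut down to m + 1, while its partner m gets no compensation.
received-pair-≡ : ∀ m → received (suc m) (pair Sign.+ m) ≡ suc (received (suc m) (pair Sign.- m))
received-pair-≡ m rewrite ℕ.⊓-idem m | ℕ.m≥n⇒m⊓n≡n (ℕ.n≤1+n m) | ℕ.m≤n⇒m⊓n≡m (ℕ.n≤1+n m) = refl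

gaps : ∀ {H} → ℕ → (Fin H → Sign) → List ℕ
gaps {zero}  m ε = []
gaps {suc H} m ε = pair (ε zero) m ++ gaps (suc m) (ε ∘ suc)

length-gaps : ∀ {H} m (ε : Fin H → Sign) → length (gaps m ε) ≡ H * 2
length-gaps {zero}  m ε = refl
length-gaps {suc H} m ε with ε zero
... | Sign.+ = cong (2 +_) (length-gaps (suc m) (ε ∘ suc))
... | Sign.- = cong (2 +_) (length-gaps (suc m) (ε ∘ suc))

-- This makes M, and with it N, the same for all sign vectors.
sum-gaps : ∀ {H} m (ε ε′ : Fin H → Sign) → sum (gaps m ε) ≡ sum (gaps m ε′)
sum-gaps {zero}  m ε ε′ = refl
sum-gaps {suc H} m ε ε′ = begin
  sum (pair (ε zero) m ++ gaps (suc m) (ε ∘ suc))         ≡⟨ ℕ.sum-++ (pair (ε zero) m) _ ⟩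
  sum (pair (ε zero) m) + sum (gaps (suc m) (ε ∘ suc))
    ≡⟨ cong₂ _+_ (trans (sum-pair (ε zero) m) (sym (sum-pair (ε′ zero) m))) (sum-gaps (suc m) (ε ∘ suc) (ε′ ∘ suc)) ⟩
  sum (pair (ε′ zero) m) + sum (gaps (suc m) (ε′ ∘ suc))  ≡⟨ ℕ.sum-++ (pair (ε′ zero) m) _ ⟨
  sum (pair (ε′ zero) m ++ gaps (suc m) (ε′ ∘ suc))       ∎
  where open ≡-Reasoning

gaps≤ : ∀ {H} m (ε : Fin H → Sign) → All (_≤ suc (m + H)) (gaps m ε)
gaps≤ {zero}  m ε = []
gaps≤ {suc H} m ε = All.++⁺ (pair≤ (ε zero))
  (subst (λ b → All (_≤ suc b) (gaps (suc m) (ε ∘ suc))) (sym (ℕ.+-suc m H)) (gaps≤ (suc m) (ε ∘ suc)))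
  where
  2+m≤ : suc (suc m) ≤ suc (m + suc H)
  2+m≤ = s≤s (ℕ.≤-trans (s≤s (ℕ.m≤m+n m H)) (ℕ.≤-reflexive (sym (ℕ.+-suc m H))))
  pair≤ : ∀ s → All (_≤ suc (m + suc H)) (pair s m)
  pair≤ Sign.+ = ℕ.<⇒≤ 2+m≤ ∷ ℕ.<⇒≤ 2+m≤ ∷ []
  pair≤ Sign.- = ℕ.<⇒≤ (ℕ.<⇒≤ 2+m≤) ∷ 2+m≤ ∷ []

received-gaps-below : ∀ {H} m (ε ε′ : Fin H → Sign) {h} → h ≤ m → received h (gaps m ε) ≡ received h (gaps m ε′)
received-gaps-below {zero}  m ε ε′ h≤m = refl
received-gaps-below {suc H} m ε ε′ {h} h≤m = begin
  received h (pair (ε zero) m ++ gaps (suc m) (ε ∘ suc))               ≡⟨ received-++ h (pair (ε zero) m) _ ⟩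
  received h (pair (ε zero) m) + received h (gaps (suc m) (ε ∘ suc))
    ≡⟨ cong₂ _+_ (received-pair-≢ (ε zero) (ε′ zero) (ℕ.<⇒≢ (s≤s h≤m))) (received-gaps-below (suc m) (ε ∘ suc) (ε′ ∘ suc) (ℕ.m≤n⇒m≤1+n h≤m)) ⟩
  received h (pair (ε′ zero) m) + received h (gaps (suc m) (ε′ ∘ suc)) ≡⟨ received-++ h (pair (ε′ zero) m) _ ⟨
  received h (pair (ε′ zero) m ++ gaps (suc m) (ε′ ∘ suc))             ∎
  where open ≡-Reasoning

-- Only the pair of index `i` distinguishes its two forms at this h: the pairs before it fall under
-- `received-pair-≢`, those after it under `received-gaps-below`.
received-gaps-at : ∀ {H} m (ε ε′ : Fin H → Sign) i → ε i ≡ Sign.+ → ε′ i ≡ Sign.- →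
  received (suc (m + toℕ i)) (gaps m ε) ≡ suc (received (suc (m + toℕ i)) (gaps m ε′))
received-gaps-at {suc H} m ε ε′ zero ε₀≡+ ε′₀≡- rewrite ε₀≡+ | ε′₀≡- | ℕ.+-identityʳ m = begin
  received (suc m) (pair Sign.+ m ++ gaps (suc m) (ε ∘ suc))
    ≡⟨ received-++ (suc m) (pair Sign.+ m) (gaps (suc m) (ε ∘ suc)) ⟩
  received (suc m) (pair Sign.+ m) + received (suc m) (gaps (suc m) (ε ∘ suc))
    ≡⟨ cong₂ _+_ (received-pair-≡ m) (received-gaps-below (suc m) (ε ∘ suc) (ε′ ∘ suc) ℕ.≤-refl) ⟩
  suc (received (suc m) (pair Sign.- m) + received (suc m) (gaps (suc m) (ε′ ∘ suc)))
    ≡⟨ cong suc (received-++ (suc m) (pair Sign.- m) (gaps (suc m) (ε′ ∘ suc))) ⟨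
  suc (received (suc m) (pair Sign.- m ++ gaps (suc m) (ε′ ∘ suc)))             ∎
  where open ≡-Reasoning
received-gaps-at {suc H} m ε ε′ (suc i) εᵢ≡+ ε′ᵢ≡- = begin
  received h (pair (ε zero) m ++ gaps (suc m) (ε ∘ suc))
    ≡⟨ received-++ h (pair (ε zero) m) _ ⟩
  received h (pair (ε zero) m) + received h (gaps (suc m) (ε ∘ suc))
    ≡⟨ cong₂ _+_ (received-pair-≢ (ε zero) (ε′ zero) h≢1+m) rest ⟩
  received h (pair (ε′ zero) m) + suc (received h (gaps (suc m) (ε′ ∘ suc)))
    ≡⟨ ℕ.+-suc (received h (pair (ε′ zero) m)) _ ⟩
  suc (received h (pair (ε′ zero) m) + received h (gaps (suc m) (ε′ ∘ suc)))
    ≡⟨ cong suc (received-++ h (pair (ε′ zero) m) _) ⟨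
  suc (received h (pair (ε′ zero) m ++ gaps (suc m) (ε′ ∘ suc)))              ∎
  where
  open ≡-Reasoning
  h : ℕ
  h = suc (m + suc (toℕ i))
  h≢1+m : h ≢ suc m
  h≢1+m = ℕ.>⇒≢ (s≤s (ℕ.m<m+n m z<s))
  rest : received h (gaps (suc m) (ε ∘ suc)) ≡ suc (received h (gaps (suc m) (ε′ ∘ suc)))
  rest = subst (λ n → received (suc n) (gaps (suc m) (ε ∘ suc)) ≡ suc (received (suc n) (gaps (suc m) (ε′ ∘ suc))))
    (sym (ℕ.+-suc m (toℕ i))) (received-gaps-at (suc m) (ε ∘ suc) (ε′ ∘ suc) i εᵢ≡+ ε′ᵢ≡-)

length-padded : ∀ L ws → length (padded L ws) ≡ L + (length ws + L)
length-padded L ws = trans (List.length-++ (replicate L 1)) (cong₂ _+_ (List.length-replicate L)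
  (trans (List.length-++ ws) (cong (length ws +_) (List.length-replicate L))))

received-padded : ∀ h L ws →
  received h (padded L ws) ≡ received h (replicate L 1) + (received h ws + received h (replicate L 1))
received-padded h L ws = trans (received-++ h (replicate L 1) _)
  (cong (received h (replicate L 1) +_) (received-++ h ws _))

module _ {H : ℕ} where

  private
    L = suc H

    width-gaps : ∀ (ε ε′ : Fin H → Sign) → width H (gaps 0 ε) ≡ width H (gaps 0 ε′)
    width-gaps ε ε′ = begin
      sum (padded L (gaps 0 ε))                                 ≡⟨ sum-padded (gaps 0 ε) ⟩
      sum (replicate L 1) + (sum (gaps 0 ε) + sum (replicate L 1))
        ≡⟨ cong (λ w → sum (replicate L 1) + (w + sum (replicate L 1))) (sum-gaps 0 ε ε′) ⟩
      sum (replicate L 1) + (sum (gaps 0 ε′) + sum (replicate L 1))  ≡⟨ sum-padded (gaps 0 ε′) ⟨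
      sum (padded L (gaps 0 ε′))                                ∎
      where
      open ≡-Reasoning
      sum-padded : ∀ ws → sum (padded L ws) ≡ sum (replicate L 1) + (sum ws + sum (replicate L 1))
      sum-padded ws = trans (ℕ.sum-++ (replicate L 1) _) (cong (sum (replicate L 1) +_) (ℕ.sum-++ ws _))

  -- Two elements are 0 and 1; T has at most one point more than gaps, and there are 2H gaps in the
  -- pairs and 2(H + 1) in the padding.
  ∣witness∣≤ : ∀ (ε : Fin H → Sign) → ∣ witness H (gaps 0 ε) ∣ ≤ 5 + 4 * H
  ∣witness∣≤ ε = begin
    ∣ witness H (gaps 0 ε) ∣               ≤⟨ ∣∣≤length (witness H (gaps 0 ε)) ⟩
    length (witness H (gaps 0 ε))
      ≡⟨ cong (2 +_) (trans (List.length-map _ (partialSums (padded L (gaps 0 ε)))) (length-partialSums (padded L (gaps 0 ε)))) ⟩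
    3 + length (padded L (gaps 0 ε))       ≡⟨ cong (3 +_) (length-padded L (gaps 0 ε)) ⟩
    3 + (L + (length (gaps 0 ε) + L))      ≡⟨ cong (λ n → 3 + (L + (n + L))) (length-gaps 0 ε) ⟩
    3 + (L + (H * 2 + L))                  ≡⟨ rearrange H ⟩
    5 + 4 * H                              ∎
    where
    open ℕ.≤-Reasoning
    rearrange : ∀ H → 3 + (suc H + (H * 2 + suc H)) ≡ 5 + 4 * H
    rearrange = ℕ.solve-∀

  -- The parts outside the block have equal size, and the blocks differ by the one element gained at
  -- the pair of `i`.
  witness-< : ∀ (ε ε′ : Fin H → Sign) i → ε i ≡ Sign.+ → ε′ i ≡ Sign.- →
    ∣ suc (toℕ i) · witness H (gaps 0 ε′) ∣ < ∣ suc (toℕ i) · witness H (gaps 0 ε) ∣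
  witness-< ε ε′ i εᵢ≡+ ε′ᵢ≡- = ℕ.≤-reflexive (begin
    suc ∣ h · witness H us ∣
      ≡⟨ cong suc (∣h·witness∣ H us (s≤s z≤n) h≤H) ⟩
    suc (length (fill h (padded L us)) + remainder H us h)
      ≡⟨ cong₂ _+_ lengths (remainder-cong H us ws (gaps≤ 0 ε′) (gaps≤ 0 ε) (width-gaps ε′ ε) h≤H) ⟩
    length (fill h (padded L ws)) + remainder H ws h               ≡⟨ ∣h·witness∣ H ws (s≤s z≤n) h≤H ⟨
    ∣ h · witness H ws ∣                                           ∎)
    where
    open ≡-Reasoning
    h = suc (toℕ i)
    us = gaps 0 ε′
    ws = gaps 0 ε
    h≤H : h ≤ H
    h≤H = Fin.toℕ<n i
    r = received h (replicate L 1)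
    lengths : suc (length (fill h (padded L us))) ≡ length (fill h (padded L ws))
    lengths = begin
      suc (length (fill h (padded L us)))
        ≡⟨ cong suc (trans (length-fill h (padded L us)) (cong (_+ h) (received-padded h L us))) ⟩
      suc (r + (received h us + r) + h)    ≡⟨ cong (_+ h) (ℕ.+-suc r (received h us + r)) ⟨
      r + (suc (received h us) + r) + h
        ≡⟨ cong (λ n → r + (n + r) + h) (received-gaps-at 0 ε ε′ i εᵢ≡+ ε′ᵢ≡-) ⟨
      r + (received h ws + r) + h
        ≡⟨ trans (length-fill h (padded L ws)) (cong (_+ h) (received-padded h L ws)) ⟨
      length (fill h (padded L ws))        ∎

-- Giving B the opposite signs puts every index into the situation of `witness-<`, in one direction
-- or the other.
realises-linear : ∀ H → Realises H (5 + 4 * H)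
realises-linear H ε =
  witness H (gaps 0 ε) , witness H (gaps 0 (opposite ∘ ε)) , ∣witness∣≤ ε , ∣witness∣≤ (opposite ∘ ε) , sign
  where
  m<n⇒m-n<0 : ∀ {m n} → m < n → ℤ.+ m ℤ.- ℤ.+ n ℤ.< 0ℤ
  m<n⇒m-n<0 {m} {n} m<n = subst (ℤ.+ m ℤ.- ℤ.+ n ℤ.<_) (ℤ.+-inverseʳ (ℤ.+ n)) (ℤ.+-monoˡ-< (ℤ.- (ℤ.+ n)) (ℤ.+<+ m<n))

  m<n⇒0<n-m : ∀ {m n} → m < n → 0ℤ ℤ.< ℤ.+ n ℤ.- ℤ.+ m
  m<n⇒0<n-m {m} {n} m<n = subst (ℤ._< ℤ.+ n ℤ.- ℤ.+ m) (ℤ.+-inverseʳ (ℤ.+ m)) (ℤ.+-monoˡ-< (ℤ.- (ℤ.+ m)) (ℤ.+<+ m<n))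

  sign : ∀ i → HasSign (ε i)
    (ℤ.+ ∣ suc (toℕ i) · witness H (gaps 0 ε) ∣ ℤ.- ℤ.+ ∣ suc (toℕ i) · witness H (gaps 0 (opposite ∘ ε)) ∣)
  sign i with ε i in eq
  ... | Sign.+ = m<n⇒0<n-m (witness-< ε (opposite ∘ ε) i eq (cong opposite eq))
  ... | Sign.- = m<n⇒m-n<0 (witness-< (opposite ∘ ε) ε i (cong opposite eq) eq)

-- Zero patterns of linear forms

infix 7 _∙_

_∙_ : ∀ {k} → Vec ℤ k → Vec ℤ k → ℤ
[]      ∙ []      = 0ℤ
(c ∷ f) ∙ (x ∷ a) = c ℤ.* x ℤ.+ f ∙ a

-- Cross-multiplication keeps the coefficients integral; the first coefficient of c·g - d·f is 0 and
-- is dropped.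
eliminate : ∀ {k} → Vec ℤ (suc k) → Vec ℤ (suc k) → Vec ℤ k
eliminate (c ∷ f) (d ∷ g) = Vec.zipWith (λ u v → c ℤ.* v ℤ.- d ℤ.* u) f g

∙-combination : ∀ {k} c d (f g a : Vec ℤ k) →
  Vec.zipWith (λ u v → c ℤ.* v ℤ.- d ℤ.* u) f g ∙ a ≡ c ℤ.* (g ∙ a) ℤ.- d ℤ.* (f ∙ a)
∙-combination c d [] [] [] = base c d
  where
  base : ∀ c d → 0ℤ ≡ c ℤ.* 0ℤ ℤ.- d ℤ.* 0ℤ
  base = ℤ.solve-∀
∙-combination c d (u ∷ f) (v ∷ g) (x ∷ a) = trans
  (cong (λ w → (c ℤ.* v ℤ.- d ℤ.* u) ℤ.* x ℤ.+ w) (∙-combination c d f g a)) (step c d u v x (f ∙ a) (g ∙ a))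
  where
  step : ∀ c d u v x y z →
    (c ℤ.* v ℤ.- d ℤ.* u) ℤ.* x ℤ.+ (c ℤ.* z ℤ.- d ℤ.* y) ≡ c ℤ.* (v ℤ.* x ℤ.+ z) ℤ.- d ℤ.* (u ℤ.* x ℤ.+ y)
  step = ℤ.solve-∀

-- As f vanishes at the point, subtracting d·f changes nothing there. If moreover `head f` is
-- nonzero, the eliminated form vanishes exactly when g does.
eliminate-∙ : ∀ {k} (f g : Vec ℤ (suc k)) x a → f ∙ (x ∷ a) ≡ 0ℤ →
  eliminate f g ∙ a ≡ head f ℤ.* (g ∙ (x ∷ a))
eliminate-∙ (c ∷ f) (d ∷ g) x a f∙a≡0 = begin
  Vec.zipWith (λ u v → c ℤ.* v ℤ.- d ℤ.* u) f g ∙ a                    ≡⟨ ∙-combination c d f g a ⟩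
  c ℤ.* (g ∙ a) ℤ.- d ℤ.* (f ∙ a)                                       ≡⟨ rearrange c d x (f ∙ a) (g ∙ a) ⟩
  c ℤ.* (d ℤ.* x ℤ.+ g ∙ a) ℤ.- d ℤ.* (c ℤ.* x ℤ.+ f ∙ a)
    ≡⟨ cong (λ z → c ℤ.* (d ℤ.* x ℤ.+ g ∙ a) ℤ.- d ℤ.* z) f∙a≡0 ⟩
  c ℤ.* (d ℤ.* x ℤ.+ g ∙ a) ℤ.- d ℤ.* 0ℤ
    ≡⟨ vanish (c ℤ.* (d ℤ.* x ℤ.+ g ∙ a)) d ⟩
  c ℤ.* (d ℤ.* x ℤ.+ g ∙ a)                                             ∎
  where
  open ≡-Reasoning
  rearrange : ∀ c d x y z → c ℤ.* z ℤ.- d ℤ.* y ≡ c ℤ.* (d ℤ.* x ℤ.+ z) ℤ.- d ℤ.* (c ℤ.* x ℤ.+ y)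
  rearrange = ℤ.solve-∀
  vanish : ∀ z d → z ℤ.- d ℤ.* 0ℤ ≡ z
  vanish = ℤ.solve-∀

-- The candidate zero patterns of the forms F i, i ∈ is.  Either some form involving the
-- first variable vanishes, and then it eliminates that variable from all the others, or
-- no such form vanishes, and then the forms not involving the first variable decide.
patterns : ∀ {I : Set} k → List I → (I → Vec ℤ k) → List (I → Bool)
patterns zero    is F = (λ _ → true) ∷ []
patterns (suc k) is F =
  map (λ p i → does (head (F i) ℤ.≟ 0ℤ) ∧ p i) (patterns k is (tail ∘ F)) ++
  concatMap (λ j → patterns k is (eliminate (F j) ∘ F)) is

length-concatMap : ∀ {A B : Set} (f : A → List B) {n} → (∀ x → length (f x) ≡ n) →
  ∀ xs → length (concatMap f xs) ≡ length xs * n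
length-concatMap f eq []       = refl
length-concatMap f eq (x ∷ xs) = trans (List.length-++ (f x)) (cong₂ _+_ (eq x) (length-concatMap f eq xs))

-- Each variable multiplies the count by 1 + m, for m forms: one branch without pivot and one for
-- each choice of a pivot.
length-patterns : ∀ {I : Set} k (is : List I) F → length (patterns k is F) ≡ suc (length is) ^ k
length-patterns zero    is F = refl
length-patterns (suc k) is F = trans (List.length-++ (map _ (patterns k is (tail ∘ F))))
  (cong₂ _+_ (trans (List.length-map _ (patterns k is (tail ∘ F))) (length-patterns k is (tail ∘ F)))
    (length-concatMap _ (λ j → length-patterns k is (eliminate (F j) ∘ F)) is))

patterns-complete : ∀ {I : Set} k (is : List I) F (a : Vec ℤ k) →
  ∃ λ p → p ∈ patterns k is F × (∀ {i} → i ∈ is → p i ≡ does (F i ∙ a ℤ.≟ 0ℤ))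
patterns-complete zero    is F [] = (λ _ → true) , here refl ,
  λ {i} _ → sym (dec-true (F i ∙ [] ℤ.≟ 0ℤ) (zero-form (F i)))
  where
  zero-form : ∀ (f : Vec ℤ 0) → f ∙ [] ≡ 0ℤ
  zero-form [] = refl
patterns-complete (suc k) is F (x ∷ a)
  with any? (λ j → ¬? (head (F j) ℤ.≟ 0ℤ) ×-dec F j ∙ (x ∷ a) ℤ.≟ 0ℤ) is
... | yes some with find some
...   | j , j∈is , c≢0 , Fj≡0 with patterns-complete k is (eliminate (F j) ∘ F) a
...     | p , p∈ , p≡ = p
        , Mem.∈-++⁺ʳ _ (Mem.∈-concatMap⁺ (λ j → patterns k is (eliminate (F j) ∘ F)) (lose j∈is p∈))
        , λ {i} i∈ → trans (p≡ i∈) (does-⇔ (mk⇔ (to i) (from i))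
            (eliminate (F j) (F i) ∙ a ℤ.≟ 0ℤ) (F i ∙ (x ∷ a) ℤ.≟ 0ℤ))
  where
  to : ∀ i → eliminate (F j) (F i) ∙ a ≡ 0ℤ → F i ∙ (x ∷ a) ≡ 0ℤ
  to i e≡0 with ℤ.i*j≡0⇒i≡0∨j≡0 (head (F j)) (trans (sym (eliminate-∙ (F j) (F i) x a Fj≡0)) e≡0)
  ... | inj₁ c≡0 = contradiction c≡0 c≢0
  ... | inj₂ Fi≡0 = Fi≡0
  from : ∀ i → F i ∙ (x ∷ a) ≡ 0ℤ → eliminate (F j) (F i) ∙ a ≡ 0ℤ
  from i Fi≡0 = trans (eliminate-∙ (F j) (F i) x a Fj≡0)
    (trans (cong (head (F j) ℤ.*_) Fi≡0) (ℤ.*-zeroʳ (head (F j))))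
patterns-complete (suc k) is F (x ∷ a) | no none with patterns-complete k is (tail ∘ F) a
... | p , p∈ , p≡ = (λ i → does (head (F i) ℤ.≟ 0ℤ) ∧ p i) , Mem.∈-++⁺ˡ (Mem.∈-map⁺ _ p∈) , agrees
  where
  split : ∀ (f : Vec ℤ (suc k)) → f ∙ (x ∷ a) ≡ head f ℤ.* x ℤ.+ tail f ∙ a
  split (c ∷ f) = refl

  agrees : ∀ {i} → i ∈ is → does (head (F i) ℤ.≟ 0ℤ) ∧ p i ≡ does (F i ∙ (x ∷ a) ℤ.≟ 0ℤ)
  agrees {i} i∈ with head (F i) ℤ.≟ 0ℤ
  -- By `none`, a form involving the first variable does not vanish; the remaining forms ignore `x`.
  ... | no  c≢0 = sym (dec-false (F i ∙ (x ∷ a) ℤ.≟ 0ℤ) λ Fi≡0 → none (lose i∈ (c≢0 , Fi≡0)))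
  ... | yes c≡0 = trans (p≡ i∈) (cong (λ z → does (z ℤ.≟ 0ℤ))
          (sym (trans (split (F i)) (trans (cong (λ c → c ℤ.* x ℤ.+ tail (F i) ∙ a) c≡0)
            (trans (cong (ℤ._+ tail (F i) ∙ a) (ℤ.*-zeroˡ x)) (ℤ.+-identityˡ (tail (F i) ∙ a)))))))

-- Sumset sizes from zero patterns

filter-map-cong : ∀ {A : Set} {f g : A → ℤ} {x} ys → (∀ {y} → y ∈ ys → f x ≡ f y ⇔ g x ≡ g y) →
  ∃ λ zs → zs ⊆ ys × filter (¬? ∘ (f x ℤ.≟_)) (map f ys) ≡ map f zs × filter (¬? ∘ (g x ℤ.≟_)) (map g ys) ≡ map g zs
filter-map-cong [] _ = [] , id , refl , refl
filter-map-cong {f = f} {g} {x} (y ∷ ys) f⇔g with filter-map-cong {f = f} {g} ys (f⇔g ∘ there) | f x ℤ.≟ f y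
... | zs , zs⊆ , f≡ , g≡ | yes fx≡fy = zs , there ∘ zs⊆
    , f≡
    , trans (List.filter-reject (¬? ∘ (g x ℤ.≟_)) {g y} {map g ys}
        (λ ≢ → ≢ (Equivalence.to (f⇔g (here refl)) fx≡fy))) g≡
... | zs , zs⊆ , f≡ , g≡ | no  fx≢fy = y ∷ zs , (λ { (here refl) → here refl ; (there z∈) → there (zs⊆ z∈) })
    , cong (f y ∷_) f≡
    , trans (List.filter-accept (¬? ∘ (g x ℤ.≟_)) {g y} {map g ys}
        (fx≢fy ∘ Equivalence.from (f⇔g (here refl)))) (cong (g y ∷_) g≡)

-- Deduplication proceeds by equality tests alone, and these come out the same under `f` and `g`, so
-- the same arguments `zs` survive in both lists.
deduplicate-map-cong : ∀ {A : Set} {f g : A → ℤ} xs → (∀ {x y} → x ∈ xs → y ∈ xs → f x ≡ f y ⇔ g x ≡ g y) →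
  ∃ λ zs → zs ⊆ xs × deduplicate ℤ._≟_ (map f xs) ≡ map f zs × deduplicate ℤ._≟_ (map g xs) ≡ map g zs
deduplicate-map-cong [] _ = [] , id , refl , refl
deduplicate-map-cong {f = f} {g} (x ∷ xs) f⇔g
  with deduplicate-map-cong {f = f} {g} xs (λ x∈ y∈ → f⇔g (there x∈) (there y∈))
... | ys , ys⊆ , f≡ , g≡ with filter-map-cong {f = f} {g} {x} ys (f⇔g (here refl) ∘ there ∘ ys⊆)
...   | zs , zs⊆ , f≡′ , g≡′ = x ∷ zs , (λ { (here refl) → here refl ; (there z∈) → there (ys⊆ (zs⊆ z∈)) })
    , cong (f x ∷_) (trans (cong (filter _) f≡) f≡′) , cong (g x ∷_) (trans (cong (filter _) g≡) g≡′)

∣map∣-cong : ∀ {A : Set} {f g : A → ℤ} xs → (∀ {x y} → x ∈ xs → y ∈ xs → f x ≡ f y ⇔ g x ≡ g y) →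
  ∣ map f xs ∣ ≡ ∣ map g xs ∣
∣map∣-cong {f = f} {g} xs f⇔g with deduplicate-map-cong {f = f} {g} xs f⇔g
... | zs , _ , f≡ , g≡ = trans (cong length f≡) (trans (List.length-map f zs)
    (sym (trans (cong length g≡) (List.length-map g zs))))

eval : ∀ {k} → Vec ℤ k → Vec ℕ k → ℤ
eval a m = Vec.map ℤ.+_ m ∙ a

units : ∀ k → List (Vec ℕ k)
units zero    = []
units (suc k) = (1 ∷ Vec.replicate k 0) ∷ map (0 ∷_) (units k)

-- The entries tell how often each aᵢ occurs in an h-fold sum. The recursion follows that of `_·_`,
-- so that `·-toList` is an equality of lists, order and repetitions included.
multiplicities : ∀ k → ℕ → List (Vec ℕ k)
multiplicities k zero    = Vec.replicate k 0 ∷ []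
multiplicities k (suc h) = cartesianProductWith (Vec.zipWith _+_) (units k) (multiplicities k h)

eval-replicate-0 : ∀ {k} (a : Vec ℤ k) → eval a (Vec.replicate k 0) ≡ 0ℤ
eval-replicate-0 []      = refl
eval-replicate-0 (x ∷ a) = trans (cong₂ ℤ._+_ (ℤ.*-zeroˡ x) (eval-replicate-0 a)) refl

eval-+ : ∀ {k} (a : Vec ℤ k) m n → eval a (Vec.zipWith _+_ m n) ≡ eval a m ℤ.+ eval a n
eval-+ []      []      []      = refl
eval-+ (x ∷ a) (i ∷ m) (j ∷ n) = trans (cong₂ (λ u v → u ℤ.* x ℤ.+ v) (ℤ.pos-+ i j) (eval-+ a m n))
  (rearrange (ℤ.+ i) (ℤ.+ j) x (eval a m) (eval a n))
  where
  rearrange : ∀ i j x y z → (i ℤ.+ j) ℤ.* x ℤ.+ (y ℤ.+ z) ≡ (i ℤ.* x ℤ.+ y) ℤ.+ (j ℤ.* x ℤ.+ z)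
  rearrange = ℤ.solve-∀

map-eval-units : ∀ {k} (a : Vec ℤ k) → map (eval a) (units k) ≡ Vec.toList a
map-eval-units []      = refl
map-eval-units {suc k} (x ∷ a) = cong₂ _∷_
  (trans (cong₂ ℤ._+_ (ℤ.*-identityˡ x) (eval-replicate-0 a)) (ℤ.+-identityʳ x))
  (trans (sym (List.map-∘ (units k))) (trans
    (List.map-cong (λ m → trans (cong (ℤ._+ eval a m) (ℤ.*-zeroˡ x)) (ℤ.+-identityˡ (eval a m))) (units k))
    (map-eval-units a)))

map-cartesianProductWith : ∀ {A : Set} {f : A → ℤ} {_⊕_ : A → A → A} → (∀ x y → f (x ⊕ y) ≡ f x ℤ.+ f y) → ∀ xs ys →
  cartesianProductWith ℤ._+_ (map f xs) (map f ys) ≡ map f (cartesianProductWith _⊕_ xs ys)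
map-cartesianProductWith         homo []       ys = refl
map-cartesianProductWith {f = f} {_⊕_} homo (x ∷ xs) ys = trans
  (cong₂ _++_ (trans (sym (List.map-∘ ys)) (trans (List.map-cong (sym ∘ homo x) ys) (List.map-∘ ys)))
    (map-cartesianProductWith homo xs ys))
  (sym (List.map-++ f (map (x ⊕_) ys) _))

·-toList : ∀ {k} (a : Vec ℤ k) h → h · Vec.toList a ≡ map (eval a) (multiplicities k h)
·-toList a zero    = cong (_∷ []) (sym (eval-replicate-0 a))
·-toList {k} a (suc h) = trans (cong₂ (cartesianProductWith ℤ._+_) (sym (map-eval-units a)) (·-toList a h))
  (map-cartesianProductWith (eval-+ a) (units k) (multiplicities k h))

Bounded : ∀ {k} → ℕ → Vec ℕ k → Set
Bounded h = VecAll.All (_≤ h)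

0-bounded : ∀ k {h} → Bounded h (Vec.replicate k 0)
0-bounded zero    = []
0-bounded (suc k) = z≤n ∷ 0-bounded k

units-bounded : ∀ k {m} → m ∈ units k → Bounded 1 m
units-bounded (suc k) (here refl) = s≤s z≤n ∷ 0-bounded k
units-bounded (suc k) (there m∈) with Mem.∈-map⁻ (0 ∷_) m∈
... | m , m∈ , refl = z≤n ∷ units-bounded k m∈

+-bounded : ∀ {k i j} {m n : Vec ℕ k} → Bounded i m → Bounded j n → Bounded (i + j) (Vec.zipWith _+_ m n)
+-bounded {m = []}    {[]}    []       []       = []
+-bounded {m = _ ∷ _} {_ ∷ _} (p ∷ ps) (q ∷ qs) = ℕ.+-mono-≤ p q ∷ +-bounded ps qs

multiplicities-bounded : ∀ k h {m} → m ∈ multiplicities k h → Bounded h m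
multiplicities-bounded k zero    (here refl) = 0-bounded k
multiplicities-bounded k (suc h) m∈
  with Mem.∈-cartesianProductWith⁻ (Vec.zipWith _+_) (units k) (multiplicities k h) m∈
... | u , n , u∈ , n∈ , refl = +-bounded (units-bounded k u∈) (multiplicities-bounded k h n∈)

interval : ℕ → List ℤ
interval H = map (λ n → ℤ.+ n ℤ.- ℤ.+ H) (upTo (suc (H + H)))

box : ∀ k → ℕ → List (Vec ℤ k)
box zero    H = [] ∷ []
box (suc k) H = concatMap (λ c → map (c ∷_) (box k H)) (interval H)

length-box : ∀ k H → length (box k H) ≡ suc (H + H) ^ k
length-box zero    H = refl
length-box (suc k) H = trans
  (length-concatMap (λ c → map (c ∷_) (box k H)) (λ c → trans (List.length-map (c ∷_) (box k H)) (length-box k H))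
    (interval H))
  (cong (_* suc (H + H) ^ k) (trans (List.length-map _ (upTo (suc (H + H)))) (List.length-upTo (suc (H + H)))))

difference : ∀ {k} → Vec ℕ k → Vec ℕ k → Vec ℤ k
difference = Vec.zipWith λ i j → ℤ.+ i ℤ.- ℤ.+ j

difference-∙ : ∀ {k} (m n : Vec ℕ k) a → difference m n ∙ a ≡ eval a m ℤ.- eval a n
difference-∙ []      []      []      = refl
difference-∙ (i ∷ m) (j ∷ n) (x ∷ a) = trans (cong (λ w → (ℤ.+ i ℤ.- ℤ.+ j) ℤ.* x ℤ.+ w) (difference-∙ m n a))
  (rearrange (ℤ.+ i) (ℤ.+ j) x (eval a m) (eval a n))
  where
  rearrange : ∀ i j x y z → (i ℤ.- j) ℤ.* x ℤ.+ (y ℤ.- z) ≡ (i ℤ.* x ℤ.+ y) ℤ.- (j ℤ.* x ℤ.+ z)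
  rearrange = ℤ.solve-∀

difference-∈-interval : ∀ {H i j} → i ≤ H → j ≤ H → ℤ.+ i ℤ.- ℤ.+ j ∈ interval H
difference-∈-interval {H} {i} {j} i≤H j≤H with ℕ.m≤n⇒∃[o]m+o≡n j≤H
-- With o = H - j, the number i - j is the entry of `interval H` at n = i + o.
... | o , refl = subst (_∈ interval H) eq
  (Mem.∈-map⁺ (λ n → ℤ.+ n ℤ.- ℤ.+ H) (Mem.∈-upTo⁺ (s≤s (ℕ.+-mono-≤ i≤H (ℕ.m≤n+m o j)))))
  where
  rearrange : ∀ i j o → i ℤ.+ o ℤ.- (j ℤ.+ o) ≡ i ℤ.- j
  rearrange = ℤ.solve-∀
  eq : ℤ.+ (i + o) ℤ.- ℤ.+ (j + o) ≡ ℤ.+ i ℤ.- ℤ.+ j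
  eq = trans (cong₂ ℤ._-_ (ℤ.pos-+ i o) (ℤ.pos-+ j o)) (rearrange (ℤ.+ i) (ℤ.+ j) (ℤ.+ o))

difference-∈-box : ∀ {k H} {m n : Vec ℕ k} → Bounded H m → Bounded H n → difference m n ∈ box k H
difference-∈-box {m = []}    {[]}    []       []       = here refl
difference-∈-box {m = _ ∷ _} {_ ∷ _} (p ∷ ps) (q ∷ qs) =
  Mem.∈-concatMap⁺ _ (lose (difference-∈-interval p q) (Mem.∈-map⁺ _ (difference-∈-box ps qs)))

candidates : ∀ k → ℕ → List (Vec ℤ k → Bool)
candidates k H = patterns k (box k H) id

HasPattern : ∀ {k} → ℕ → (Vec ℤ k → Bool) → Vec ℤ k → Set
HasPattern {k} H p a = ∀ {f} → f ∈ box k H → p f ≡ does (f ∙ a ℤ.≟ 0ℤ)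

-- Two h-fold sums coincide exactly when the form `difference m n` vanishes. Its coefficients lie
-- between -H and H, so `p` records whether it does.
collisions-⊆ : ∀ {k H p h} {a b : Vec ℤ k} → HasPattern H p a → HasPattern H p b → h ≤ H →
  ∀ {m n} → m ∈ multiplicities k h → n ∈ multiplicities k h → eval a m ≡ eval a n → eval b m ≡ eval b n
collisions-⊆ {k} {H} {p} {h} {a} {b} pa pb h≤H {m} {n} m∈ n∈ eq = ℤ.i-j≡0⇒i≡j (eval b m) (eval b n)
  (trans (sym (difference-∙ m n b)) zero-b)
  where
  bounded : ∀ {m} → m ∈ multiplicities k h → Bounded H m
  bounded m∈ = VecAll.map (λ i≤h → ℕ.≤-trans i≤h h≤H) (multiplicities-bounded k h m∈)
  f∈ : difference m n ∈ box k H
  f∈ = difference-∈-box (bounded m∈) (bounded n∈)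
  zero-a : difference m n ∙ a ≡ 0ℤ
  zero-a = trans (difference-∙ m n a) (ℤ.i≡j⇒i-j≡0 eq)
  zero-b : difference m n ∙ b ≡ 0ℤ
  -- Both decisions equal the same value of `p`, which is true because of `zero-a`.
  zero-b with difference m n ∙ b ℤ.≟ 0ℤ
    | trans (sym (pb f∈)) (trans (pa f∈) (dec-true (difference m n ∙ a ℤ.≟ 0ℤ) zero-a))
  ... | yes ≡0 | _ = ≡0

∣h·toList∣-cong : ∀ {k H p h} {a b : Vec ℤ k} → HasPattern H p a → HasPattern H p b → h ≤ H →
  ∣ h · Vec.toList a ∣ ≡ ∣ h · Vec.toList b ∣
∣h·toList∣-cong {k} {p = p} {h} {a} {b} pa pb h≤H rewrite ·-toList a h | ·-toList b h =
  ∣map∣-cong (multiplicities k h)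
  λ m∈ n∈ → mk⇔ (collisions-⊆ {p = p} pa pb h≤H m∈ n∈) (collisions-⊆ {p = p} pb pa h≤H m∈ n∈)

-- Counting sign vectors

·-⊆ : ∀ h {X Y} → X ⊆ Y → h · X ⊆ h · Y
·-⊆ zero    X⊆Y z∈ = z∈
·-⊆ (suc h) {X} X⊆Y z∈ with Mem.∈-cartesianProductWith⁻ ℤ._+_ X (h · X) z∈
... | x , y , x∈ , y∈ , refl = Mem.∈-cartesianProductWith⁺ ℤ._+_ (X⊆Y x∈) (·-⊆ h X⊆Y y∈)

-- Repeating `x` turns every nonempty set of at most k elements into a point of ℤᵏ. In use, `x` is
-- an element of the set, so the set stays the same.
pad : ∀ k → ℤ → List ℤ → Vec ℤ k
pad zero    x ys       = []
pad (suc k) x []       = x ∷ pad k x []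
pad (suc k) x (y ∷ ys) = y ∷ pad k x ys

pad-⊆ : ∀ k {x ys} → Vec.toList (pad k x ys) ⊆ x ∷ ys
pad-⊆ (suc k) {ys = []}     (here refl) = here refl
pad-⊆ (suc k) {ys = []}     (there z∈)  = pad-⊆ k z∈
pad-⊆ (suc k) {ys = y ∷ ys} (here refl) = there (here refl)
pad-⊆ (suc k) {ys = y ∷ ys} (there z∈) with pad-⊆ k z∈
... | here z≡x  = here z≡x
... | there z∈′ = there (there z∈′)

⊆-pad : ∀ {k x ys} → length ys ≤ k → ys ⊆ Vec.toList (pad k x ys)
⊆-pad {suc k} {ys = y ∷ ys} (s≤s len) (here refl) = here refl
⊆-pad {suc k} {ys = y ∷ ys} (s≤s len) (there z∈)  = there (⊆-pad len z∈)

-- The code `zero` is reserved for the empty set, which has no element to pad with.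
Describes : ∀ k H → Fin (suc (length (candidates k H))) → List ℤ → Set
Describes k H zero    A = A ⊆ []
Describes k H (suc c) A = ∃ λ (a : Vec ℤ k) →
  A ⊆ Vec.toList a × Vec.toList a ⊆ A × HasPattern H (lookup (candidates k H) c) a

description : ∀ k H A → ∣ A ∣ ≤ k → ∃ λ c → Describes k H c A
description k H A ∣A∣≤k = from-enumeration (deduplicate ℤ._≟_ A) ∣A∣≤k
  (Mem.∈-deduplicate⁺ ℤ._≟_) (Mem.∈-deduplicate⁻ ℤ._≟_ A)
  where
  from-enumeration : ∀ X → length X ≤ k → A ⊆ X → X ⊆ A → ∃ λ c → Describes k H c A
  from-enumeration []      _    A⊆X _   = zero , A⊆X
  from-enumeration (x ∷ X) len≤ A⊆X X⊆A with patterns-complete k (box k H) id (pad k x (x ∷ X))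
  ... | p , p∈ , p≡ = suc (Any.index p∈) , pad k x (x ∷ X) , ⊆-pad len≤ ∘ A⊆X , X⊆A ∘ drop-x ∘ pad-⊆ k
      , λ {f} f∈ → trans (cong (λ p → p f) (sym (Any.lookup-index p∈))) (p≡ f∈)
    where
    drop-x : x ∷ x ∷ X ⊆ x ∷ X
    drop-x (here refl) = here refl
    drop-x (there z∈)  = z∈

Describes⇒∣h·∣≡ : ∀ k H c {A B} → Describes k H c A → Describes k H c B → ∀ {h} → h ≤ H → ∣ h · A ∣ ≡ ∣ h · B ∣
Describes⇒∣h·∣≡ k H zero    A⊆[] B⊆[] {h} _ = ∣∣-cong (·-⊆ h (absurd ∘ A⊆[])) (·-⊆ h (absurd ∘ B⊆[]))
  where
  absurd : ∀ {X} → [] ⊆ X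
  absurd ()
Describes⇒∣h·∣≡ k H (suc c) (a , A⊆a , a⊆A , pa) (b , B⊆b , b⊆B , pb) {h} h≤H =
  trans (∣∣-cong (·-⊆ h A⊆a) (·-⊆ h a⊆A))
  (trans (∣h·toList∣-cong {p = lookup (candidates k H) c} {h = h} pa pb h≤H)
  (∣∣-cong (·-⊆ h b⊆B) (·-⊆ h B⊆b)))

HasSign-unique : ∀ {s t z} → HasSign s z → HasSign t z → s ≡ t
HasSign-unique {Sign.+} {Sign.+} _   _   = refl
HasSign-unique {Sign.+} {Sign.-} 0<z z<0 = contradiction z<0 (ℤ.<-asym 0<z)
HasSign-unique {Sign.-} {Sign.+} z<0 0<z = contradiction z<0 (ℤ.<-asym 0<z)
HasSign-unique {Sign.-} {Sign.-} _   _   = refl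

funToFin-cong : ∀ {m n} {f g : Fin m → Fin n} → f ≗ g → funToFin f ≡ funToFin g
funToFin-cong {zero}  f≗g = refl
funToFin-cong {suc m} f≗g = cong₂ combine (f≗g zero) (funToFin-cong (f≗g ∘ suc))

finToSign : Fin 2 → Sign
finToSign zero       = Sign.+
finToSign (suc zero) = Sign.-

finToSign-injective : ∀ {i j} → finToSign i ≡ finToSign j → i ≡ j
finToSign-injective {zero}     {zero}     _ = refl
finToSign-injective {zero}     {suc zero} ()
finToSign-injective {suc zero} {zero}     ()
finToSign-injective {suc zero} {suc zero} _ = refl

-- Pigeonhole: each sign vector is sent to the codes of its sets A and B. Equal codes force equal
-- sizes of hA and hB for all h ≤ H, hence equal signs.
Realises⇒2^H≤ : ∀ {H k} → Realises H k → 2 ^ H ≤ suc (length (candidates k H)) * suc (length (candidates k H))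
Realises⇒2^H≤ {H} {k} real = ℕ.≮⇒≥ absurd
  where
  N = suc (length (candidates k H))

  signs : Fin (2 ^ H) → Fin H → Sign
  signs x i = finToSign (finToFun x i)

  signs-injective : ∀ x y → (∀ i → signs x i ≡ signs y i) → x ≡ y
  signs-injective x y eq = trans (sym (Fin.funToFin-finToFin {H} x))
    (trans (funToFin-cong (finToSign-injective ∘ eq)) (Fin.funToFin-finToFin {H} y))

  A B : Fin (2 ^ H) → List ℤ
  A x = proj₁ (real (signs x))
  B x = proj₁ (proj₂ (real (signs x)))

  descA : ∀ x → ∃ λ c → Describes k H c (A x)
  descA x = description k H (A x) (proj₁ (proj₂ (proj₂ (real (signs x)))))

  descB : ∀ x → ∃ λ c → Describes k H c (B x)
  descB x = description k H (B x) (proj₁ (proj₂ (proj₂ (proj₂ (real (signs x))))))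

  hasSigns : ∀ x i → HasSign (signs x i) (ℤ.+ ∣ suc (toℕ i) · A x ∣ ℤ.- ℤ.+ ∣ suc (toℕ i) · B x ∣)
  hasSigns x = proj₂ (proj₂ (proj₂ (proj₂ (real (signs x)))))

  code : Fin (2 ^ H) → Fin (N * N)
  code x = combine (proj₁ (descA x)) (proj₁ (descB x))

  code-injective : ∀ x y → code x ≡ code y → x ≡ y
  code-injective x y eq = signs-injective x y λ i → HasSign-unique (hasSigns x i)
    (subst (HasSign (signs y i)) (sym (cong₂ (λ a b → ℤ.+ a ℤ.- ℤ.+ b) (sameA i) (sameB i))) (hasSigns y i))
    where
    cA≡ : proj₁ (descA x) ≡ proj₁ (descA y)
    cA≡ = Fin.combine-injectiveˡ (proj₁ (descA x)) (proj₁ (descB x)) (proj₁ (descA y)) (proj₁ (descB y)) eq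
    cB≡ : proj₁ (descB x) ≡ proj₁ (descB y)
    cB≡ = Fin.combine-injectiveʳ (proj₁ (descA x)) (proj₁ (descB x)) (proj₁ (descA y)) (proj₁ (descB y)) eq
    sameA : ∀ i → ∣ suc (toℕ i) · A x ∣ ≡ ∣ suc (toℕ i) · A y ∣
    sameA i = Describes⇒∣h·∣≡ k H (proj₁ (descA y))
      (subst (λ c → Describes k H c (A x)) cA≡ (proj₂ (descA x))) (proj₂ (descA y)) (Fin.toℕ<n i)
    sameB : ∀ i → ∣ suc (toℕ i) · B x ∣ ≡ ∣ suc (toℕ i) · B y ∣
    sameB i = Describes⇒∣h·∣≡ k H (proj₁ (descB y))
      (subst (λ c → Describes k H c (B x)) cB≡ (proj₂ (descB x))) (proj₂ (descB y)) (Fin.toℕ<n i)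

  absurd : ¬ N * N < 2 ^ H
  absurd N²<2^H with Fin.pigeonhole N²<2^H code
  ... | x , y , x<y , eq = contradiction (code-injective x y eq) (Fin.<⇒≢ x<y)

-- Comparison with the real bounds

n≤2^m⇒1+n≤2^[1+m] : ∀ {n} m → n ≤ 2 ^ m → suc n ≤ 2 ^ suc m
n≤2^m⇒1+n≤2^[1+m] m n≤ = ℕ.+-mono-≤ (ℕ.m^n>0 2 m) (ℕ.≤-trans n≤ (ℕ.m≤m+n (2 ^ m) 0))

-- The exponent is ⌊log₂ (n + 1)⌋.
binary-magnitude : ∀ n → ∃ λ t → 2 ^ t ≤ suc n × suc n < 2 ^ suc t
binary-magnitude zero = 0 , ℕ.≤-refl , ℕ.≤-refl
binary-magnitude (suc n) with binary-magnitude n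
... | t , 2^t≤ , <2^1+t with suc (suc n) ℕ.<? 2 ^ suc t
...   | yes < = t , ℕ.m≤n⇒m≤1+n 2^t≤ , <
...   | no  ≮ = suc t , ℕ.≮⇒≥ ≮ , ℕ.<-≤-trans (s≤s <2^1+t) (n≤2^m⇒1+n≤2^[1+m] (suc t) ℕ.≤-refl)

length-candidates : ∀ k H → length (candidates k H) ≡ suc (suc (H + H) ^ k) ^ k
length-candidates k H = trans (length-patterns k (box k H) _) (cong (λ m → suc m ^ k) (length-box k H))

-- Here 2H + 1 ≤ 2^(t + 2), and each added 1 is absorbed by one more factor 2.
candidates-bound : ∀ k H t → H < 2 ^ suc t → suc (length (candidates k H)) ≤ 2 ^ suc (suc ((2 + t) * k) * k)
candidates-bound k H t H<2^1+t = n≤2^m⇒1+n≤2^[1+m] (suc ((2 + t) * k) * k) (begin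
  length (candidates k H)        ≡⟨ length-candidates k H ⟩
  suc (suc (H + H) ^ k) ^ k      ≤⟨ ℕ.^-monoˡ-≤ k (n≤2^m⇒1+n≤2^[1+m] ((2 + t) * k) forms) ⟩
  (2 ^ suc ((2 + t) * k)) ^ k    ≡⟨ ℕ.^-*-assoc 2 (suc ((2 + t) * k)) k ⟩
  2 ^ (suc ((2 + t) * k) * k)    ∎)
  where
  open ℕ.≤-Reasoning
  1+2H≤ : suc (H + H) ≤ 2 ^ (2 + t)
  1+2H≤ = ℕ.+-mono-≤ H<2^1+t (ℕ.≤-trans (ℕ.<⇒≤ H<2^1+t) (ℕ.m≤m+n (2 ^ suc t) 0))
  forms : suc (H + H) ^ k ≤ 2 ^ ((2 + t) * k)
  forms = ℕ.≤-trans (ℕ.^-monoˡ-≤ k 1+2H≤) (ℕ.≤-reflexive (ℕ.^-*-assoc 2 (2 + t) k))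

Realises⇒H≤ : ∀ {H k} t → Realises H k → H < 2 ^ suc t → H ≤ 2 * suc (suc ((2 + t) * k) * k)
Realises⇒H≤ {H} {k} t real H<2^1+t = ℕ.≮⇒≥ λ 2E<H → ℕ.<⇒≱ (ℕ.^-monoʳ-< 2 (s≤s (s≤s z≤n)) 2E<H) (begin
  2 ^ H                ≤⟨ Realises⇒2^H≤ real ⟩
  suc N * suc N        ≤⟨ ℕ.*-mono-≤ (candidates-bound k H t H<2^1+t) (candidates-bound k H t H<2^1+t) ⟩
  2 ^ E * 2 ^ E        ≡⟨ ℕ.^-distribˡ-+-* 2 E E ⟨
  2 ^ (E + E)          ≡⟨ cong (λ e → 2 ^ (E + e)) (ℕ.+-identityʳ E) ⟨
  2 ^ (2 * E)          ∎)
  where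
  open ℕ.≤-Reasoning
  N = length (candidates k H)
  E = suc (suc ((2 + t) * k) * k)

-- For k, t ≥ 1, the bound 4(1 + k + (2 + t)k²) is at most 20k²t. The next square 25 is taken
-- because its root gives the constant 1/5.
2H≤25κ²t : ∀ {H k t} → 3 ≤ H → Realises H k → 2 ^ t ≤ H → H < 2 ^ suc t →
  NonZero k × NonZero t × H * 2 ≤ 25 * (k * k) * t
-- For k = 0 the bound would read H ≤ 2, and t = 0 would mean H < 2.
2H≤25κ²t {H} {zero} {t} 3≤H real _ H<2^1+t = contradiction (ℕ.≤-trans (Realises⇒H≤ t real H<2^1+t)
  (ℕ.≤-reflexive (cong (λ n → 2 * suc n) (ℕ.*-zeroʳ (suc ((2 + t) * 0)))))) (ℕ.<⇒≱ 3≤H)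
2H≤25κ²t {k = suc _} {zero} 3≤H _ _ H<2 = contradiction H<2 (ℕ.≤⇒≯ (ℕ.<⇒≤ 3≤H))
2H≤25κ²t {H} {k@(suc i)} {t@(suc j)} 3≤H real _ H<2^1+t = _ , _ , (begin
  H * 2                                   ≤⟨ ℕ.*-monoˡ-≤ 2 (Realises⇒H≤ t real H<2^1+t) ⟩
  2 * suc (suc ((2 + t) * k) * k) * 2     ≤⟨ ℕ.m≤m+n _ _ ⟩
  -- The added polynomial is the difference of the two sides, written in i = k - 1 and j = t - 1;
  -- its coefficients are all nonnegative.
  2 * suc (suc ((2 + t) * k) * k) * 2 + (5 + 21 * j + 22 * i + 42 * (i * j) + 13 * (i * i) + 21 * (i * i * j))
    ≡⟨ expand i j ⟩
  25 * (k * k) * t                        ∎)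
  where
  open ℕ.≤-Reasoning
  expand : ∀ i j →
    2 * suc (suc ((3 + j) * suc i) * suc i) * 2 + (5 + 21 * j + 22 * i + 42 * (i * j) + 13 * (i * i) + 21 * (i * i * j))
    ≡ 25 * (suc i * suc i) * suc j
  expand = ℕ.solve-∀

natℚ-* : ∀ m n → natℚ m ℚ.* natℚ n ≡ natℚ (m * n)
natℚ-* m n = trans (fromℚᵘ-homo-* (mkℚᵘ (ℤ.+ m) 0) (mkℚᵘ (ℤ.+ n) 0))
  (cong (λ z → ℚ.fromℚᵘ (mkℚᵘ z 0)) (sym (ℤ.pos-* m n)))

natℚ-mono-≤ : ∀ {m n} → m ≤ n → natℚ m ℚ.≤ natℚ n
natℚ-mono-≤ {m} {n} m≤n = ℚ.toℚᵘ-cancel-≤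
  (ℚᵘ.≤-respˡ-≃ (ℚᵘ.≃-sym (ℚ.toℚᵘ-fromℚᵘ (mkℚᵘ (ℤ.+ m) 0)))
  (ℚᵘ.≤-respʳ-≃ (ℚᵘ.≃-sym (ℚ.toℚᵘ-fromℚᵘ (mkℚᵘ (ℤ.+ n) 0)))
    (ℚᵘ.*≤* (ℤ.*-monoʳ-≤-nonNeg (ℤ.+ 1) (+≤+ m≤n)))))

natℚ⁺ : ∀ n → .{{NonZero n}} → ℚ⁺
natℚ⁺ n = ⟨ natℚ n ⟩ {{ℚ.normalize-pos n 1}}

-- Oresme's grouping: the 2^t terms 1/k with 2^t < k ≤ 2^(t + 1) are each at least 1/2^(t + 1),
-- hence add up to at least 1/2.
harmonic-log : ∀ t n → 2 ^ t ≤ suc n → natℚ t ℚ.* ½ ℚ.≤ harmonic 2 n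
harmonic-log zero    n _    = ℚ.≤-trans (ℚ.≤-reflexive (ℚ.*-zeroˡ ½)) (harmonic-nonNegative 2 n)
harmonic-log (suc t) n 2^≤n with 2 ^ t in 2^t≡ | ℕ.m^n>0 2 t
-- Here 2^t = p + 1, and `r` is the number of terms beyond the last full group.
... | suc p | _ with ℕ.m≤n⇒∃[o]m+o≡n (ℕ.≤-pred 2^≤n)
...   | r , refl = begin
  natℚ (suc t) ℚ.* ½                                                                 ≡⟨ natℚ-suc-* t ½ ⟩
  ½ ℚ.+ natℚ t ℚ.* ½
    ≡⟨ ℚ.+-comm ½ (natℚ t ℚ.* ½) ⟩
  natℚ t ℚ.* ½ ℚ.+ ½
    ≤⟨ ℚ.+-mono-≤ (harmonic-log t p (ℕ.≤-reflexive 2^t≡)) (ℚ.≤-trans block (ℚ.≤-reflexive (sym (ℚ.+-identityʳ _)))) ⟩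
  harmonic 2 p ℚ.+ (harmonic (2 + p) (suc p) ℚ.+ 0ℚ)
    ≤⟨ ℚ.+-monoʳ-≤ (harmonic 2 p) (ℚ.+-monoʳ-≤ (harmonic (2 + p) (suc p)) (harmonic-nonNegative (2 + p + suc p) r)) ⟩
  harmonic 2 p ℚ.+ (harmonic (2 + p) (suc p) ℚ.+ harmonic (2 + p + suc p) r)
    ≡⟨ cong (harmonic 2 p ℚ.+_) (harmonic-split (2 + p) (suc p) r) ⟨
  harmonic 2 p ℚ.+ harmonic (2 + p) (suc p + r)
    ≡⟨ harmonic-split 2 p (suc p + r) ⟨
  harmonic 2 (p + (suc p + r))
    ≡⟨ cong (λ N → harmonic 2 N) (rearrange p r) ⟩
  harmonic 2 (p + suc (p + 0) + r)                                                   ∎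
  where
  open ℚ.≤-Reasoning
  rearrange : ∀ p r → p + (suc p + r) ≡ p + suc (p + 0) + r
  rearrange = ℕ.solve-∀
  block : ½ ℚ.≤ harmonic (2 + p) (suc p)
  block = ℚ.≤-trans (ℚ.≤-reflexive (sym (unitFraction-refine 2 (suc p))))
    (harmonic-≥ (2 + p) (suc p) (2 * suc p)
      (ℕ.≤-reflexive (cong (λ q → suc (suc p + suc q)) (sym (ℕ.+-identityʳ p)))))

-- The lower Riemann sum with step length 1 is 1/2 + ... + 1/H, and no upper sum falls below it.
log-lower : ∀ H t M → 2 ^ t ≤ H → natℚ t ℚ.* ½ ℚ.≤ upperSum H M
log-lower zero    t M 2^t≤0 = contradiction 2^t≤0 (ℕ.<⇒≱ (ℕ.m^n>0 2 t))
log-lower (suc n) t M 2^t≤H = ℚ.≤-trans (harmonic-log t n 2^t≤H)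
  (ℚ.≤-trans (ℚ.≤-reflexive (cong (λ N → harmonic 2 N) (sym (ℕ.*-identityʳ n)))) (lowerSum≤upperSum (suc n) 0 M))

square-cancel-<⁺ : ∀ {p q} → p *⁺ p <⁺ q *⁺ q → p <⁺ q
square-cancel-<⁺ {p} {q} p²<q² with ℚ.<-cmp (val p) (val q)
... | tri< p<q _ _ = mk<⁺ p<q
... | tri≈ _ p≡q _ = contradiction (un<⁺ p²<q²) (ℚ.<-irrefl (cong (λ r → val (r *⁺ r)) (val-injective p≡q)))
... | tri> _ _ q<p = contradiction (un<⁺ (*⁺-mono (mk<⁺ q<p) (mk<⁺ q<p))) (ℚ.<-asym (un<⁺ p²<q²))

⅕ : ℚ⁺
⅕ = ⟨ ℤ.+ 1 ℚ./ 5 ⟩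

module _ {H κ t : ℕ} .{{_ : NonZero κ}} .{{_ : NonZero t}} (H*2≤25κ²t : H * 2 ≤ 25 * (κ * κ) * t) where

  private
    instance
      25κ²≢0 : NonZero (25 * (κ * κ))
      25κ²≢0 = ℕ.m*n≢0 25 (κ * κ) {{_}} {{ℕ.m*n≢0 κ κ}}

    -- Since τ = t/2 bounds log H from below and Xτ bounds H from above, H / log H is at most X =
    -- (5κ)².
    K X τ : ℚ⁺
    K = natℚ⁺ κ
    X = natℚ⁺ (25 * (κ * κ))
    τ = natℚ⁺ t *⁺ ⟨ ½ ⟩

  H≤Xτ : natℚ H ℚ.≤ val (X *⁺ τ)
  H≤Xτ = begin
    natℚ H                               ≡⟨ ℚ.*-identityʳ (natℚ H) ⟨
    natℚ H ℚ.* (natℚ 2 ℚ.* ½)            ≡⟨ ℚ.*-assoc (natℚ H) (natℚ 2) ½ ⟨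
    natℚ H ℚ.* natℚ 2 ℚ.* ½              ≡⟨ cong (ℚ._* ½) (natℚ-* H 2) ⟩
    natℚ (H * 2) ℚ.* ½                   ≤⟨ ℚ.*-monoʳ-≤-nonNeg ½ (natℚ-mono-≤ H*2≤25κ²t) ⟩
    natℚ (25 * (κ * κ) * t) ℚ.* ½        ≡⟨ cong (ℚ._* ½) (natℚ-* (25 * (κ * κ)) t) ⟨
    val X ℚ.* natℚ t ℚ.* ½               ≡⟨ ℚ.*-assoc (val X) (natℚ t) ½ ⟩
    val X ℚ.* (natℚ t ℚ.* ½)             ≡⟨ cong (val X ℚ.*_) (val-*⁺ (natℚ⁺ t) ⟨ ½ ⟩) ⟨
    val X ℚ.* val τ                      ≡⟨ val-*⁺ X τ ⟨
    val (X *⁺ τ)                         ∎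
    where open ℚ.≤-Reasoning

  ⅕⅕X≡KK : (⅕ *⁺ ⅕) *⁺ X ≡ K *⁺ K
  ⅕⅕X≡KK = val-injective (begin
    val ((⅕ *⁺ ⅕) *⁺ X)
      ≡⟨ trans (val-*⁺ (⅕ *⁺ ⅕) X) (cong (ℚ._* val X) (val-*⁺ ⅕ ⅕)) ⟩
    val ⅕ ℚ.* val ⅕ ℚ.* natℚ (25 * (κ * κ))            ≡⟨ cong (val ⅕ ℚ.* val ⅕ ℚ.*_) (natℚ-* 25 (κ * κ)) ⟨
    val ⅕ ℚ.* val ⅕ ℚ.* (natℚ 25 ℚ.* natℚ (κ * κ))
      ≡⟨ ℚ.*-assoc (val ⅕ ℚ.* val ⅕) (natℚ 25) (natℚ (κ * κ)) ⟨
    val ⅕ ℚ.* val ⅕ ℚ.* natℚ 25 ℚ.* natℚ (κ * κ)       ≡⟨ ℚ.*-identityˡ (natℚ (κ * κ)) ⟩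
    natℚ (κ * κ)                                       ≡⟨ natℚ-* κ κ ⟨
    natℚ κ ℚ.* natℚ κ                                  ≡⟨ val-*⁺ K K ⟨
    val (K *⁺ K)                                       ∎)
    where open ≡-Reasoning

  -- Comparing squares avoids roots: (ab)² = a²·uv is less than (1/25)·Xτ·τ⁻¹ = κ².
  root-bound : ∀ {M a b u v} → 2 ^ t ≤ H → val a ℚ.< val ⅕ → val u ℚ.< natℚ H → upperSum H M ℚ.< val (inv⁺ v) →
    b *⁺ b ≡ u *⁺ v → a *⁺ b <⁺ K
  root-bound {M} {a} {b} {u} {v} 2^t≤H a<⅕ u<H log<v⁻¹ b²≡uv = square-cancel-<⁺
    (subst₂ _<⁺_ (trans (cong ((a *⁺ a) *⁺_) (sym b²≡uv)) (*⁺-interchange a a b b))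
      (trans (cong ((⅕ *⁺ ⅕) *⁺_) ([p*r]*r⁻¹≡p X τ)) ⅕⅕X≡KK)
      (*⁺-mono (*⁺-mono (mk<⁺ a<⅕) (mk<⁺ a<⅕)) (*⁺-mono u<Xτ v<τ⁻¹)))
    where
    u<Xτ : u <⁺ X *⁺ τ
    u<Xτ = mk<⁺ (ℚ.<-≤-trans u<H H≤Xτ)
    τ<v⁻¹ : τ <⁺ inv⁺ v
    τ<v⁻¹ = mk<⁺ (ℚ.≤-<-trans (ℚ.≤-trans (ℚ.≤-reflexive (val-*⁺ (natℚ⁺ t) ⟨ ½ ⟩)) (log-lower H t M 2^t≤H)) log<v⁻¹)
    v<τ⁻¹ : v <⁺ inv⁺ τ
    v<τ⁻¹ = subst (_<⁺ inv⁺ τ) (inv⁺-involutive v) (inv⁺-antitone τ<v⁻¹)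

κ-lower : ∀ {H κ} (3≤H : 3 ≤ H) → Realises H κ →
  fromℚ (val ⅕) *ᴿ √ (fromℕ H /ᴿ log H [ log-positive (ℕ.<⇒≤ 3≤H) ]) ≤ᴿ fromℕ κ
-- A rational in the lower cut of c√(H / log H) is q = ab with a < 1/5 and b² = uv, where u < H and
-- 1/v exceeds some upper sum of log H.
κ-lower {suc n} {κ} 3≤H real q (a , b , a<⅕ , (u , v , u<H , (M , log<v⁻¹) , b²≡uv) , q≡ab)
  with t , 2^t≤H , H<2^1+t ← binary-magnitude n
  with κ≢0 , t≢0 , bound ← 2H≤25κ²t {t = t} 3≤H real 2^t≤H H<2^1+t
  = subst (λ r → val r ℚ.< natℚ κ) (sym q≡ab)
      (un<⁺ (root-bound {{κ≢0}} {{t≢0}} bound {M} 2^t≤H a<⅕ u<H log<v⁻¹ b²≡uv))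

-- From H ≥ 3 one gets κ ≤ 5 + 4H ≤ 6H. The lower cut of a product asks for factors strictly below 7
-- and H; 6 and q/6 are such, which is why the constant is 7 instead of 6.
κ-upper : ∀ {H κ} → 3 ≤ H → κ ≤ 5 + 4 * H → fromℕ κ ≤ᴿ fromℕ 7 *ᴿ fromℕ H
κ-upper {H} {κ} 3≤H κ≤ q q<κ = natℚ⁺ 6 , q *⁺ inv⁺ (natℚ⁺ 6) , 6<7 , un<⁺ q/6<H ,
  sym (trans (*⁺-comm (natℚ⁺ 6) _) ([p*r⁻¹]*r≡p q (natℚ⁺ 6)))
  where
  instance
    H≢0 : NonZero H
    H≢0 = ℕ.>-nonZero (ℕ.≤-trans (s≤s z≤n) 3≤H)

  6<7 : natℚ 6 ℚ.< natℚ 7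
  6<7 = ℚ.*<* (+<+ ℕ.≤-refl)

  κ≤H*6 : κ ≤ H * 6
  κ≤H*6 = begin
    κ               ≤⟨ κ≤ ⟩
    5 + 4 * H       ≤⟨ ℕ.+-monoˡ-≤ (4 * H) (ℕ.≤-trans (ℕ.n≤1+n 5) (ℕ.*-monoʳ-≤ 2 3≤H)) ⟩
    2 * H + 4 * H   ≡⟨ collect H ⟩
    H * 6           ∎
    where
    open ℕ.≤-Reasoning
    collect : ∀ H → 2 * H + 4 * H ≡ H * 6
    collect = ℕ.solve-∀

  q/6<H : q *⁺ inv⁺ (natℚ⁺ 6) <⁺ natℚ⁺ H
  q/6<H = *⁺-cancelʳ (natℚ⁺ 6) (subst (_<⁺ natℚ⁺ H *⁺ natℚ⁺ 6) (sym ([p*r⁻¹]*r≡p q (natℚ⁺ 6)))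
    (mk<⁺ (ℚ.<-≤-trans q<κ (ℚ.≤-trans (natℚ-mono-≤ κ≤H*6)
      (ℚ.≤-reflexive (trans (sym (natℚ-* H 6)) (sym (val-*⁺ (natℚ⁺ H) (natℚ⁺ 6)))))))))

theorem1p6 : Σ[ c ∈ ℝ≥0 ] Σ[ C ∈ ℝ≥0 ] Positive c × Positive C ×
    (∀ (H : ℕ) (3≤H : 3 ≤ H) (κ : ℕ) → Isκ H κ →
    (c *ᴿ √ (fromℕ H /ᴿ log H [ log-positive (<⇒≤ 3≤H) ]) ≤ᴿ fromℕ κ)
    × (fromℕ κ ≤ᴿ C *ᴿ fromℕ H))
-- The rationals 1/6 and 1 witness that c = 1/5 and C = 7 are positive.
theorem1p6 = fromℚ (val ⅕) , fromℕ 7 , (⟨ ℤ.+ 1 ℚ./ 6 ⟩ , ℚ.*<* (+<+ ℕ.≤-refl)) , (1⁺ , ℚ.*<* (+<+ (s≤s (s≤s z≤n)))) ,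
  λ H 3≤H κ (realises , least) → κ-lower 3≤H realises , κ-upper 3≤H (least (5 + 4 * H) (realises-linear H))
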